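{- Let $\mathcal{P},\mathcal{N}\subset\mathbb{Z}_{\ge0}^2$ be finite disjoint sets with $\mathcal{P}\cup\mathcal{N}\neq\emptyset$, let $A$ be the set of P-positions of the corresponding altered Wythoff game, and let $B$ be the set of P-positions of the unaltered Wythoff game. Let $t-1$ be the largest first coordinate of an element of $\mathcal{P}\cup\mathcal{N}$. Let $c=t$, let $r$ be the number of integers $y$ such that $(x,y)\in A$ for some $x\le t-1$, and let $d$ be the number of integers $k$ such that $(x,y)\in A$ for some $x\le t-1$ with $y-x=k$ (i.e. the number of diagonals of slope $1$ containing a P-position in columns $0,\dots,t-1$). Then $A_{(d-c,\,d-r)}$ is asymptotically equal to $B$.
   Context: Wythoff's game: a position is a pair $(x,y)$ of non-negative integers; the first coordinate $x$ is the column and $y$ the row. A move from $(x,y)$ goes to $(x-k,y)$, $(x,y-k)$ or $(x-k,y-k)$ for some integer $k\ge1$, provided the resulting coordinates are non-negative. An altered Wythoff game is given by finite disjoint sets $\mathcal{P},\mathcal{N}\subset\mathbb{Z}_{\ge0}^2$; positions are labelled by recursion on $x+y$: positions in $\mathcal{P}$ are P, positions in $\mathcal{N}$ are N, and any other position is P if no position reachable from it in one move is labelled P, and N otherwise. The set of P-positions is the set of positions labelled P. The unaltered game is $\mathcal{P}=\mathcal{N}=\emptyset$; its P-positions are $B=\{(\lfloor\phi n\rfloor,\lfloor\phi^2 n\rfloor):n\ge0\}\cup\{(\lfloor\phi^2 n\rfloor,\lfloor\phi n\rfloor):n\ge0\}$, $\phi=(1+\sqrt5)/2$. For $S\subseteq\mathbb{Z}^2$,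 $S_{(\Delta x,\Delta y)}=\{(x+\Delta x,y+\Delta y):(x,y)\in S\}$. With $B_n=\{(x,y)\in\mathbb{Z}^2:x^2+y^2\le n^2\}$, infinite sets $S,T\subseteq\mathbb{Z}^2$ are asymptotically equal if $\lim_{n\to\infty}|(S\cap T)\cap B_n|/|(S\cup T)\cap B_n|=1$. -}

module Defs where

open import Data.Nat using (ℕ; zero; suc; _+_; _*_; _∸_; _≤_; _<_; _⊔_)
open import Data.Bool using (Bool; true; false; _∧_; _∨_; not; if_then_else_)
open import Data.Integer as ℤ using (ℤ; +_; -[1+_])
open import Data.Product using (_×_; _,_; proj₁; proj₂)
open import Data.List using (List; []; _∷_; _++_; foldr; map; length)
open import Relation.Binary.PropositionalEquality using (_≡_)

Pos : Set
Pos = ℕ × ℕ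

_≡ₚ_ : Pos → Pos → Bool
(a , b) ≡ₚ (c , d) = (a Data.Nat.≡ᵇ c) ∧ (b Data.Nat.≡ᵇ d)

elemᵇ : Pos → List Pos → Bool
elemᵇ p []       = false
elemᵇ p (q ∷ qs) = (p ≡ₚ q) ∨ elemᵇ p qs

anyUpTo : ℕ → (ℕ → Bool) → Bool
anyUpTo zero    f = false
anyUpTo (suc n) f = f (suc n) ∨ anyUpTo n f

-- Labelling of the altered Wythoff game with prescribed sets 𝒫 and 𝒩,
-- by recursion on x + y (fuel f; called with f = x + y, every move
-- target (x',y') then receives fuel f - 1 ≥ x' + y').
-- true = P-position, false = N-position.
labelFuel : List Pos → List Pos → ℕ → ℕ → ℕ → Bool
labelFuel 𝒫 𝒩 f x y with elemᵇ (x , y) 𝒫 | elemᵇ (x , y) 𝒩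
... | true  | _     = true
... | false | true  = false
... | false | false = not (movesToP f)
  where
  movesToP : ℕ → Bool
  movesToP zero     = false   -- only reached for (0,0), which has no moves
  movesToP (suc f') =
       anyUpTo x (λ k → labelFuel 𝒫 𝒩 f' (x ∸ k) y)
    ∨ anyUpTo y (λ k → labelFuel 𝒫 𝒩 f' x (y ∸ k))
    ∨ anyUpTo (x Data.Nat.⊓ y) (λ k → labelFuel 𝒫 𝒩 f' (x ∸ k) (y ∸ k))

isP : List Pos → List Pos → ℕ → ℕ → Bool
isP 𝒫 𝒩 x y = labelFuel 𝒫 𝒩 (x + y) x y

SetZ² : Set
SetZ² = ℤ → ℤ → Bool

Pset : List Pos → List Pos → SetZ²
Pset 𝒫 𝒩 (+ x) (+ y) = isP 𝒫 𝒩 x y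
Pset 𝒫 𝒩 _     _     = false

shift : SetZ² → ℤ → ℤ → SetZ²
shift S Δx Δy a b = S (a ℤ.- Δx) (b ℤ.- Δy)

countDisk : SetZ² → ℕ → ℕ
countDisk S n = go (2 * n + 1)
  where
  inDisk : ℤ → ℤ → Bool
  inDisk a b = ℤ.∣ a ℤ.* a ℤ.+ b ℤ.* b ∣ Data.Nat.≤ᵇ n * n
  row : ℤ → ℕ → ℕ
  row a zero    = 0
  row a (suc j) = (let b = + j ℤ.- + n in
                   if inDisk a b ∧ S a b then 1 else 0) + row a j
  go : ℕ → ℕ
  go zero    = 0
  go (suc i) = row (+ i ℤ.- + n) (2 * n + 1) + go i

_∩_ _∪_ : SetZ² → SetZ² → SetZ²
(S ∩ T) a b = S a b ∧ T a b
(S ∪ T) a b = S a b ∨ T a b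

-- lim_{n→∞} |S∩T∩B_n| / |(S∪T)∩B_n| = 1, written without reals:
-- for every m there is N such that for all n ≥ N the denominator is
-- positive and the ratio is ≥ m/(m+1) (it is always ≤ 1).
AsymptoticallyEqual : SetZ² → SetZ² → Set
AsymptoticallyEqual S T =
  ∀ (m : ℕ) → Data.Product.∃ λ (N : ℕ) → ∀ (n : ℕ) → N ≤ n →
    (0 < countDisk (S ∪ T) n) ×
    (m * countDisk (S ∪ T) n ≤ suc m * countDisk (S ∩ T) n)

Bset : SetZ²
Bset = Pset [] []

tOf : List Pos → ℕ
tOf L = suc (foldr (λ p m → proj₁ p ⊔ m) 0 L)

{-# OPTIONS --safe #-}
module Submission where

-- Translate the game by (d - c , d - r). From column d on, each column holds exactly one
-- P-position, and the rows and diagonals used before column x number x - z (z the lowest row)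
-- and x, as in the unaltered game. The used diagonals soon fill an interval: if a diagonal k
-- inside it stayed vacant, two successive upward moves would need two adjacent used rows, and
-- strict alternation would run into a used row. After that every P-position lies on the next
-- diagonal above or below the interval. If f j is the column of the P-position on diagonal j,
-- counting rows gives the recursion
--     f j = 2 j - min { i | j ≤ f i + i },
-- which halves the difference of two solutions until it is at most 1. A difference 1 at j
-- forces j = f i + i with the same difference at i ≤ j / 2, so two solutions disagree at
-- logarithmically many places.

-- The shift is dictated by counting. Columns before `t` use `d` diagonals and `r` rows. Moving
-- column `t` to `d` and row 0 to `z = d - r` makes the used diagonals before column x number x and
-- the used rows `x - z`; each further column adds one of each. The diagonal count then ties the
-- width of the used interval to the column, and in the row count `z` cancels because the block of
-- filled rows also starts at `z`. What remains is a recursion free of all parameters of the game,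
-- so two games differ only in initial values. The unaltered game is the instance `d = z = 0` of the
-- same process.
--
-- The obstacle is that a difference of 1 need not die out: one at i can reappear at `f i + i`. So
-- the argument counts differences instead of excluding them. As `f i + i` is at least twice i for
-- large i, there are O(log n) of them below n. The P-positions in a disk of radius n grow linearly,
-- because far out the cell of column x has height at most 2x.

open import Defs

-- Certificates for linear inequalities over the integers.

module Linear where
  open import Data.Empty using (⊥)
  open import Data.Integer using (ℤ; +_; _+_; _-_; _≤_; 0ℤ; +≤+)
  open import Data.Integer.Properties
  open import Data.Nat using (suc; z≤n)
  open import Function using (_∘_)
  open import Relation.Binary.PropositionalEquality
  open import Relation.Nullary using (¬_)

  infixr 5 _⊕_

  _⊕_ : ∀ {a b c d} → a ≤ b → c ≤ d → a + c ≤ b + d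
  _⊕_ = +-mono-≤

  -- Linear inequalities are certified by a sum of hypotheses and a slack n, which leaves a ring identity.
  abstract
    lin : ∀ {a b c d} n → a ≤ b → d - c ≡ (b - a) + + n → c ≤ d
    lin n a≤b eq =
      0≤i-j⇒j≤i (subst (0ℤ ≤_) (sym eq) (+-mono-≤ {0ℤ} {_} {0ℤ} (i≤j⇒0≤j-i a≤b) (+≤+ z≤n)))

    absurd : ∀ {a b} n → a ≤ b → a - b ≡ + suc n → ⊥
    absurd n a≤b eq with subst (_≤ 0ℤ) eq (i≤j⇒i-j≤0 a≤b)
    ... | +≤+ ()

    ≤-both : ∀ {a b} → a ≤ b → b ≤ a → a ≡ b
    ≤-both = ≤-antisym

    ≡⇒≤ : ∀ {a b : ℤ} → a ≡ b → a ≤ b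
    ≡⇒≤ = ≤-reflexive

    not≤ : ∀ {a b} → ¬ a ≤ b → + 1 + b ≤ a
    not≤ = i<j⇒suc[i]≤j ∘ ≰⇒>

    ≤≢⇒< : ∀ {a b} → a ≤ b → a ≢ b → + 1 + a ≤ b
    ≤≢⇒< a≤b a≢b = i<j⇒suc[i]≤j (≤∧≢⇒< a≤b a≢b)

-- Exact cardinalities through duplicate-free lists.

module Counting where
  open import Data.Empty using (⊥-elim)
  open import Data.Integer using (ℤ; +_; _+_; _-_; _≤_; _≤?_)
  open import Data.Integer.Properties using (≰⇒>; i<j⇒suc[i]≤j; ≤-refl)
  open import Data.Integer.Tactic.RingSolver using (solve; solve-∀)
  open import Data.List using (List; []; _∷_; _++_; length)
  open import Data.List.Membership.Propositional using (_∈_)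
  open import Data.List.Membership.Propositional.Properties using (∈-++⁺ˡ; ∈-++⁺ʳ; ∈-++⁻)
  open import Data.List.Properties using (length-++)
  open import Data.List.Relation.Unary.All as All using (All)
  import Data.List.Relation.Unary.AllPairs as AllPairs
  open import Data.List.Relation.Unary.Any using (here; there)
  open import Data.List.Relation.Unary.Unique.Propositional using (Unique)
  open import Data.List.Relation.Unary.Unique.Propositional.Properties using (++⁺)
  open import Data.Nat as ℕ using (ℕ; zero; suc; z≤n; s≤s)
  import Data.Nat.Properties as ℕ
  open import Data.Product using (∃; _×_; _,_)
  open import Data.Sum using (_⊎_; inj₁; inj₂)
  open import Function using (_∘_)
  open import Relation.Binary.PropositionalEquality
  open import Relation.Nullary using (¬_; yes; no)
  open Linear

  remove : ∀ {A : Set} {x : A} {ys} → x ∈ ys →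
    ∃ λ zs → length ys ≡ suc (length zs) × (∀ {w} → w ∈ ys → w ≢ x → w ∈ zs)
  remove {ys = y ∷ ys} (here refl) = ys , refl , λ
    { (here refl) w≢x → ⊥-elim (w≢x refl)
    ; (there w∈)  _   → w∈ }
  remove {ys = y ∷ ys} (there x∈) with remove x∈
  ... | zs , eq , keep = y ∷ zs , cong suc eq , λ
    { (here refl) _   → here refl
    ; (there w∈)  w≢x → there (keep w∈ w≢x) }

  unique-⊆⇒length≤ : ∀ {A : Set} {xs ys : List A} → Unique xs →
    (∀ {x} → x ∈ xs → x ∈ ys) → length xs ℕ.≤ length ys
  unique-⊆⇒length≤ {xs = []}     _        _ = z≤n
  unique-⊆⇒length≤ {xs = x ∷ xs} (x∉ AllPairs.∷ u) f with remove (f (here refl))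
  ... | zs , eq , keep rewrite eq =
    s≤s (unique-⊆⇒length≤ u λ w∈ → keep (f (there w∈)) λ { refl → All.lookup x∉ w∈ refl })

  -- The size is an integer because the counts that occur are differences such as `x - z`, where `z`
  -- may be negative.
  record Count {A : Set} (P : A → Set) (n : ℤ) : Set where
    constructor count
    field
      elements : List A
      unique   : Unique elements
      sound    : ∀ {k} → k ∈ elements → P k
      complete : ∀ {k} → P k → k ∈ elements
      size     : + length elements ≡ n

  -- Double counting: `width` and `recurrence` arise by evaluating one set in two ways.
  Count-unique : ∀ {A : Set} {P Q : A → Set} {m n} → Count P m → Count Q n →
    (∀ {k} → P k → Q k) → (∀ {k} → Q k → P k) → m ≡ n
  Count-unique (count xs u s c refl) (count ys u' s' c' refl) f g =
    cong +_ (ℕ.≤-antisym (unique-⊆⇒length≤ u (c' ∘ f ∘ s)) (unique-⊆⇒length≤ u' (c ∘ g ∘ s')))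

  Count-add : ∀ {A : Set} {P Q : A → Set} {n} a → Count P n → ¬ P a → Q a →
    (∀ {k} → P k → Q k) → (∀ {k} → Q k → P k ⊎ k ≡ a) → Count Q (+ 1 + n)
  Count-add {P = P} {Q} a (count xs u s c refl) ¬Pa Qa f g = count (a ∷ xs)
    (All.tabulate (λ { k∈ refl → ¬Pa (s k∈) }) AllPairs.∷ u)
    (λ { (here refl) → Qa ; (there k∈) → f (s k∈) })
    complete' refl
    where
    complete' : ∀ {k} → Q k → k ∈ a ∷ xs
    complete' q with g q
    ... | inj₁ p    = there (c p)
    ... | inj₂ refl = here refl

  Count-⊎ : ∀ {A : Set} {P Q R : A → Set} {m n} → Count P (+ m) → Count Q (+ n) → (∀ {k} → P k → ¬ Q k) →
    (∀ {k} → P k ⊎ Q k → R k) → (∀ {k} → R k → P k ⊎ Q k) → Count R (+ (m ℕ.+ n))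
  Count-⊎ {A} {P} {Q} {R} (count xs u s c refl) (count ys u' s' c' refl) disjoint f g = count (xs ++ ys)
    (++⁺ u u' λ (k∈ , k∈') → disjoint (s k∈) (s' k∈'))
    (λ k∈ → f (sound' (∈-++⁻ xs k∈))) (λ r → complete' (g r)) (cong +_ (length-++ xs))
    where
    sound' : ∀ {k} → k ∈ xs ⊎ k ∈ ys → P k ⊎ Q k
    sound' (inj₁ k∈) = inj₁ (s k∈)
    sound' (inj₂ k∈) = inj₂ (s' k∈)
    complete' : ∀ {k} → P k ⊎ Q k → k ∈ xs ++ ys
    complete' (inj₁ p) = ∈-++⁺ˡ (c p)
    complete' (inj₂ q) = ∈-++⁺ʳ xs (c' q)

  Interval : ℤ → ℤ → ℤ → Set
  Interval lo hi k = lo ≤ k × + 1 + k ≤ hi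

  interval-length : ∀ lo n → Count (Interval lo (lo + + n)) (+ n)
  interval-length lo zero = count [] AllPairs.[] (λ ()) (λ {k} (l , h) → ⊥-elim (absurd 0 (l ⊕ h) (solve (lo ∷ k ∷ [])))) refl
  interval-length lo (suc n) = Count-add (lo + + n) (interval-length lo n)
    (λ (_ , h) → absurd 0 h (e₁ lo (+ n)))
    (lin n (≤-refl {lo}) (e₂ lo (+ n)) , lin 0 (≤-refl {lo}) (e₃ lo (+ n)))
    (λ {k} (l , h) → l , lin 1 h (e₄ lo k (+ n)))
    below
    where
    e₁ : ∀ lo n → + 1 + (lo + n) - (lo + n) ≡ + 1
    e₁ = solve-∀
    e₂ : ∀ lo n → lo + n - lo ≡ lo - lo + n
    e₂ = solve-∀
    e₃ : ∀ lo n → lo + (+ 1 + n) - (+ 1 + (lo + n)) ≡ lo - lo + + 0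
    e₃ = solve-∀
    e₄ : ∀ lo k n → lo + (+ 1 + n) - (+ 1 + k) ≡ lo + n - (+ 1 + k) + + 1
    e₄ = solve-∀
    e₅ : ∀ lo k n → lo + n - k ≡ lo + (+ 1 + n) - (+ 1 + k) + + 0
    e₅ = solve-∀
    e₆ : ∀ lo k n → k - (lo + n) ≡ + 1 + k - (+ 1 + (lo + n)) + + 0
    e₆ = solve-∀
    below : ∀ {k} → Interval lo (lo + + suc n) k → Interval lo (lo + + n) k ⊎ k ≡ lo + + n
    below {k} (l , h) with + 1 + k ≤? lo + + n
    ... | yes h' = inj₁ (l , h')
    ... | no ¬h' = inj₂ (≤-both (lin 0 h (e₅ lo k (+ n))) (lin 0 (i<j⇒suc[i]≤j (≰⇒> ¬h')) (e₆ lo k (+ n))))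

-- The greedy process and the interval of used diagonals.

module Settling where
  open import Data.Empty using (⊥-elim)
  open import Data.Integer using (ℤ; +_; _+_; _-_; -_; _≤_; _≤?_; _≟_)
  open import Data.Integer.Properties using (≤-refl; ≤-trans; i≤suc[i])
  open import Data.Integer.Tactic.RingSolver using (solve; solve-∀)
  open import Data.List using (List; []; _∷_; length; filter)
  open import Data.List.Membership.Propositional using (_∈_; lose)
  open import Data.List.Membership.Propositional.Properties using (∈-filter⁺; ∈-filter⁻)
  open import Data.List.Properties using (filter-notAll)
  open import Data.Nat as ℕ using (ℕ)
  import Data.Nat.Properties as ℕ
  open import Data.Product using (∃; _×_; _,_; proj₁; proj₂)
  open import Data.Sum using (_⊎_; inj₁; inj₂)
  open import Relation.Binary.PropositionalEquality
  open import Relation.Nullary using (¬_; yes; no; ¬?)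
  open Linear
  open Counting

  x+k-x≡k : ∀ x k → x + k - x ≡ k
  x+k-x≡k = solve-∀

  1+[x-z]≡1+x-z : ∀ x z → + 1 + (x - z) ≡ + 1 + x - z
  1+[x-z]≡1+x-z = solve-∀

  -- Row x and Diag x are the rows and the diagonals y - x met by cells in columns before x; z is the
  -- lowest row. Integer coordinates make room for the translation.
  record Greedy : Set₁ where
    field
      d z         : ℤ
      Cell        : ℤ → ℤ → Set
      Row Diag    : ℤ → ℤ → Set
      d-nonneg    : + 0 ≤ d
      cell        : ∀ {x} → d ≤ x → ∃ (Cell x)
      cell-floor  : ∀ {x y} → d ≤ x → Cell x y → z ≤ y
      greedy      : ∀ {x y y'} → d ≤ x → Cell x y → z ≤ y' → + 1 + y' ≤ y → Row x y' ⊎ Diag x (y' - x)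
      row-fresh   : ∀ {x y} → d ≤ x → Cell x y → ¬ Row x y
      row-keep    : ∀ {x y} → Row x y → Row (+ 1 + x) y
      row-new     : ∀ {x y} → d ≤ x → Cell x y → Row (+ 1 + x) y
      row-step    : ∀ {x y y'} → d ≤ x → Cell x y → Row (+ 1 + x) y' → Row x y' ⊎ y' ≡ y
      row-floor   : ∀ {x y} → Row x y → z ≤ y
      row-count   : Count (Row d) (d - z)
      diag-fresh  : ∀ {x y} → d ≤ x → Cell x y → ¬ Diag x (y - x)
      diag-keep   : ∀ {x k} → Diag x k → Diag (+ 1 + x) k
      diag-new    : ∀ {x y} → d ≤ x → Cell x y → Diag (+ 1 + x) (y - x)
      diag-step   : ∀ {x y k} → d ≤ x → Cell x y → Diag (+ 1 + x) k → Diag x k ⊎ k ≡ y - x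
      diag-count  : Count (Diag d) d

  module _ (G : Greedy) where
    open Greedy G

    -- The used diagonals lie strictly between - b and u; H lists those in between still vacant.
    record State (x b u : ℤ) (H : List ℤ) : Set where
      field
        start  : d ≤ x
        pos    : + 0 ≤ u
        wide   : + 1 ≤ b + u
        floor  : z ≤ x + u
        inner  : ∀ {k} → Diag x k → + 1 - b ≤ k × + 1 + k ≤ u
        filled : ∀ {y} → z ≤ y → + 1 + y + b ≤ x → Row x y
        below  : ∀ {y} → Row x y → + 1 + y ≤ x + u
        holes  : ∀ {k} → + 1 - b ≤ k → + 1 + k ≤ u → Diag x k ⊎ k ∈ H
        vacant : ∀ {k} → k ∈ H → ¬ Diag x k × + 1 - b ≤ k × + 1 + k ≤ u
        rows   : Count (Row x) (x - z)
        diags  : Count (Diag x) x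

    -- An upward move skips every lower cell, so the row in which a vacant diagonal meets column `x`
    -- is used already; `up` keeps this evidence for the later contradiction. In `fill` the shorter
    -- list of holes is the termination measure.
    data Step (x b u : ℤ) (H : List ℤ) : Set where
      up   : Cell x (x + u) → (z ≤ x - b → Row x (x - b)) → (∀ {k} → k ∈ H → z ≤ x + k → Row x (x + k)) →
             State (+ 1 + x) b (+ 1 + u) H → Step x b u H
      down : Cell x (x - b) → State (+ 1 + x) (+ 1 + b) u H → Step x b u H
      fill : ∀ {H'} → length H' ℕ.< length H → State (+ 1 + x) b u H' → Step x b u H

    module _ {x b u H} (st : State x b u H) where
      open State st

      private
        under : ∀ {y} → Cell x y → ∀ {k} → z ≤ x + k → + 1 + (x + k) ≤ y → ¬ Diag x k → Row x (x + k)
        under c {k} z≤ < ¬diag with greedy start c z≤ <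
        ... | inj₁ r = r
        ... | inj₂ g = ⊥-elim (¬diag (subst (Diag x) (x+k-x≡k x k) g))

        upper : ∀ {y} → Cell x y → y ≤ x + u
        upper {y} c with y ≤? x + u
        ... | yes h = h
        ... | no ¬h = ⊥-elim (absurd 0 (below (under c floor (not≤ ¬h) λ g → absurd 0 (proj₂ (inner g)) (solve (u ∷ []))))
                                       (solve (x ∷ u ∷ [])))

        ¬Diag-b : ¬ Diag x (- b)
        ¬Diag-b g = absurd 0 (proj₁ (inner g)) (solve (b ∷ []))

        lower : ∀ {y} → Cell x y → x - b ≤ y
        lower {y} c with x - b ≤? y
        ... | yes h = h
        ... | no ¬h = ⊥-elim (row-fresh start c (filled (cell-floor start c) (lin 0 (not≤ ¬h) (solve (x ∷ y ∷ b ∷ [])))))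

        rows′ : ∀ {y} → Cell x y → Count (Row (+ 1 + x)) (+ 1 + x - z)
        rows′ {y} c = subst (Count _) (1+[x-z]≡1+x-z x z)
          (Count-add y rows (row-fresh start c) (row-new start c) row-keep (row-step start c))

        diags′ : ∀ {y} → Cell x y → Count (Diag (+ 1 + x)) (+ 1 + x)
        diags′ {y} c = Count-add (y - x) diags (diag-fresh start c) (diag-new start c) diag-keep (diag-step start c)

        up′ : Cell x (x + u) → Step x b u H
        up′ c = up c (λ z≤ → under c z≤ (lin 0 wide (solve (x ∷ b ∷ u ∷ []))) ¬Diag-b)
          (λ {k} k∈ z≤ → under c z≤ (lin 0 (proj₂ (proj₂ (vacant k∈))) (solve (x ∷ k ∷ u ∷ []))) (proj₁ (vacant k∈)))
          record
            { start  = ≤-trans start (i≤suc[i] x)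
            ; pos    = lin 1 pos (solve (u ∷ []))
            ; wide   = lin 1 wide (solve (b ∷ u ∷ []))
            ; floor  = ≤-trans floor (lin 2 (≤-refl {x}) (solve (x ∷ u ∷ [])))
            ; inner  = inner′
            ; filled = filled′
            ; below  = below′
            ; holes  = holes′
            ; vacant = vacant′
            ; rows   = rows′ c
            ; diags  = diags′ c
            }
          where
          inner′ : ∀ {k} → Diag (+ 1 + x) k → + 1 - b ≤ k × + 1 + k ≤ + 1 + u
          inner′ {k} g with diag-step start c g
          ... | inj₁ g′   = proj₁ (inner g′) , lin 1 (proj₂ (inner g′)) (solve (k ∷ u ∷ []))
          ... | inj₂ refl = lin 0 wide (solve (b ∷ x ∷ u ∷ [])) , lin 0 (≤-refl {x}) (solve (x ∷ u ∷ []))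
          filled′ : ∀ {y} → z ≤ y → + 1 + y + b ≤ + 1 + x → Row (+ 1 + x) y
          filled′ {y} z≤ h with + 1 + y + b ≤? x
          ... | yes h′ = row-keep (filled z≤ h′)
          ... | no ¬h = row-keep (subst (Row x) (sym y≡) (under c (subst (z ≤_) y≡ z≤) (lin 0 wide (solve (x ∷ b ∷ u ∷ []))) ¬Diag-b))
            where
            y≡ : y ≡ x - b
            y≡ = ≤-both (lin 0 h (solve (x ∷ y ∷ b ∷ []))) (lin 0 (not≤ ¬h) (solve (x ∷ y ∷ b ∷ [])))
          below′ : ∀ {y} → Row (+ 1 + x) y → + 1 + y ≤ + 1 + x + (+ 1 + u)
          below′ {y} r with row-step start c r
          ... | inj₁ r′   = lin 2 (below r′) (solve (x ∷ y ∷ u ∷ []))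
          ... | inj₂ refl = lin 1 (≤-refl {x}) (solve (x ∷ u ∷ []))
          holes′ : ∀ {k} → + 1 - b ≤ k → + 1 + k ≤ + 1 + u → Diag (+ 1 + x) k ⊎ k ∈ H
          holes′ {k} l h with + 1 + k ≤? u
          ... | no ¬h = inj₁ (subst (Diag (+ 1 + x)) (≤-both {x + u - x} {k} (lin 0 (not≤ ¬h) (solve (x ∷ k ∷ u ∷ [])))
                                                       (lin 0 h (solve (x ∷ k ∷ u ∷ [])))) (diag-new start c))
          ... | yes h′ with holes l h′
          ... | inj₁ g  = inj₁ (diag-keep g)
          ... | inj₂ k∈ = inj₂ k∈
          vacant′ : ∀ {k} → k ∈ H → ¬ Diag (+ 1 + x) k × + 1 - b ≤ k × + 1 + k ≤ + 1 + u
          vacant′ {k} k∈ with vacant k∈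
          ... | ¬g , l , h = ¬g′ , l , lin 1 h (solve (k ∷ u ∷ []))
            where
            ¬g′ : ¬ Diag (+ 1 + x) k
            ¬g′ g with diag-step start c g
            ... | inj₁ g′   = ¬g g′
            ... | inj₂ refl = absurd 0 h (solve (x ∷ u ∷ []))

        down′ : Cell x (x - b) → Step x b u H
        down′ c = down c record
            { start  = ≤-trans start (i≤suc[i] x)
            ; pos    = pos
            ; wide   = lin 1 wide (solve (b ∷ u ∷ []))
            ; floor  = ≤-trans floor (lin 1 (≤-refl {x}) (solve (x ∷ u ∷ [])))
            ; inner  = inner′
            -- The frontier stays put, since `x` and `b` grow together, although its row is now
            -- used. Hence a second downward move cannot follow at once.
            ; filled = λ {y} z≤ h → row-keep (filled z≤ (lin 0 h (solve (x ∷ y ∷ b ∷ []))))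
            ; below  = below′
            ; holes  = holes′
            ; vacant = vacant′
            ; rows   = rows′ c
            ; diags  = diags′ c
            }
          where
          inner′ : ∀ {k} → Diag (+ 1 + x) k → + 1 - (+ 1 + b) ≤ k × + 1 + k ≤ u
          inner′ {k} g with diag-step start c g
          ... | inj₁ g′   = lin 1 (proj₁ (inner g′)) (solve (b ∷ k ∷ [])) , proj₂ (inner g′)
          ... | inj₂ refl = lin 0 (≤-refl {x}) (solve (b ∷ x ∷ [])) , lin 0 wide (solve (x ∷ b ∷ u ∷ []))
          below′ : ∀ {y} → Row (+ 1 + x) y → + 1 + y ≤ + 1 + x + u
          below′ {y} r with row-step start c r
          ... | inj₁ r′   = lin 1 (below r′) (solve (x ∷ y ∷ u ∷ []))
          ... | inj₂ refl = lin 1 wide (solve (x ∷ b ∷ u ∷ []))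
          holes′ : ∀ {k} → + 1 - (+ 1 + b) ≤ k → + 1 + k ≤ u → Diag (+ 1 + x) k ⊎ k ∈ H
          holes′ {k} l h with + 1 - b ≤? k
          ... | no ¬l = inj₁ (subst (Diag (+ 1 + x)) (≤-both {x - b - x} {k} (lin 0 l (solve (x ∷ k ∷ b ∷ [])))
                                                       (lin 0 (not≤ ¬l) (solve (x ∷ k ∷ b ∷ [])))) (diag-new start c))
          ... | yes l′ with holes l′ h
          ... | inj₁ g  = inj₁ (diag-keep g)
          ... | inj₂ k∈ = inj₂ k∈
          vacant′ : ∀ {k} → k ∈ H → ¬ Diag (+ 1 + x) k × + 1 - (+ 1 + b) ≤ k × + 1 + k ≤ u
          vacant′ {k} k∈ with vacant k∈
          ... | ¬g , l , h = ¬g′ , lin 1 l (solve (k ∷ b ∷ [])) , h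
            where
            ¬g′ : ¬ Diag (+ 1 + x) k
            ¬g′ g with diag-step start c g
            ... | inj₁ g′   = ¬g g′
            ... | inj₂ refl = absurd 0 l (solve (x ∷ b ∷ []))

        fill′ : ∀ {y} → Cell x y → + 1 + y ≤ x + u → + 1 + (x - b) ≤ y → Step x b u H
        fill′ {y} c y< <y with holes {y - x} (lin 0 <y (solve (x ∷ y ∷ b ∷ []))) (lin 0 y< (solve (x ∷ y ∷ u ∷ [])))
        ... | inj₁ g  = ⊥-elim (diag-fresh start c g)
        -- The diagonal of a cell strictly between the two frontiers is a listed hole; striking it
        -- off shortens the list.
        ... | inj₂ i∈ = fill (filter-notAll keep? H (lose i∈ λ i≢i → i≢i refl)) record
            { start  = ≤-trans start (i≤suc[i] x)
            ; pos    = pos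
            ; wide   = wide
            ; floor  = ≤-trans floor (lin 1 (≤-refl {x}) (solve (x ∷ u ∷ [])))
            ; inner  = inner′
            ; filled = filled′
            ; below  = below′
            ; holes  = holes′
            ; vacant = vacant′
            ; rows   = rows′ c
            ; diags  = diags′ c
            }
          where
          i = y - x
          keep? = λ k → ¬? (k ≟ i)
          inner′ : ∀ {k} → Diag (+ 1 + x) k → + 1 - b ≤ k × + 1 + k ≤ u
          inner′ {k} g with diag-step start c g
          ... | inj₁ g′   = inner g′
          ... | inj₂ refl = lin 0 <y (solve (x ∷ y ∷ b ∷ [])) , lin 0 y< (solve (x ∷ y ∷ u ∷ []))
          filled′ : ∀ {v} → z ≤ v → + 1 + v + b ≤ + 1 + x → Row (+ 1 + x) v
          filled′ {v} z≤ h with + 1 + v + b ≤? x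
          ... | yes h′ = row-keep (filled z≤ h′)
          ... | no ¬h = row-keep (subst (Row x) (sym v≡) (under c (subst (z ≤_) v≡ z≤) <y ¬Diag-b))
            where
            v≡ : v ≡ x - b
            v≡ = ≤-both (lin 0 h (solve (x ∷ v ∷ b ∷ []))) (lin 0 (not≤ ¬h) (solve (x ∷ v ∷ b ∷ [])))
          below′ : ∀ {v} → Row (+ 1 + x) v → + 1 + v ≤ + 1 + x + u
          below′ {v} r with row-step start c r
          ... | inj₁ r′   = lin 1 (below r′) (solve (x ∷ v ∷ u ∷ []))
          ... | inj₂ refl = lin 1 y< (solve (x ∷ y ∷ u ∷ []))
          holes′ : ∀ {k} → + 1 - b ≤ k → + 1 + k ≤ u → Diag (+ 1 + x) k ⊎ k ∈ filter keep? H
          holes′ {k} l h with k ≟ i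
          ... | yes refl = inj₁ (diag-new start c)
          ... | no k≢i with holes l h
          ... | inj₁ g  = inj₁ (diag-keep g)
          ... | inj₂ k∈ = inj₂ (∈-filter⁺ keep? k∈ k≢i)
          vacant′ : ∀ {k} → k ∈ filter keep? H → ¬ Diag (+ 1 + x) k × + 1 - b ≤ k × + 1 + k ≤ u
          vacant′ {k} k∈ with ∈-filter⁻ keep? k∈
          ... | k∈H , k≢i with vacant k∈H
          ... | ¬g , lh = ¬g′ , lh
            where
            ¬g′ : ¬ Diag (+ 1 + x) k
            ¬g′ g with diag-step start c g
            ... | inj₁ g′ = ¬g g′
            ... | inj₂ eq = k≢i eq

      step : Step x b u H
      step with cell start
      ... | y , c with y ≟ x + u
      ... | yes refl = up′ c
      ... | no y≢u with y ≟ x - b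
      ... | yes refl = down′ c
      ... | no y≢b = fill′ c (≤≢⇒< (upper c) y≢u) (≤≢⇒< (lower c) (≢-sym y≢b))

-- Every vacant diagonal inside the interval is eventually used.

module Filling where
  open import Data.Empty using (⊥-elim)
  open import Data.Integer using (ℤ; +_; _+_; _-_; -_; _≤_; ∣_∣)
  open import Data.Integer.Properties using (≤-refl; ≤-trans; i≤suc[i]; 0≤i⇒+∣i∣≡i; i≤j⇒0≤j-i)
  open import Data.Integer.Tactic.RingSolver using (solve; solve-∀)
  open import Data.List using (List; []; _∷_; length)
  open import Data.List.Membership.Propositional using (_∈_)
  open import Data.List.Relation.Unary.Any using (here)
  open import Data.Nat as ℕ using (ℕ; zero; suc; s≤s)
  import Data.Nat.Properties as ℕ
  open import Data.Product using (∃; _×_; _,_; proj₁; proj₂)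
  open import Data.Sum using (_⊎_; inj₁; inj₂)
  open import Relation.Binary.PropositionalEquality
  open import Relation.Nullary using (¬_)
  open Linear
  open Counting
  open Settling

  2+y≰1+y : ∀ x y u → + 2 + y ≤ x + u → + 1 + y ≢ x + u
  2+y≰1+y x y u h eq = absurd 0 (h ⊕ ≡⇒≤ (sym eq)) (solve (x ∷ y ∷ u ∷ []))

  2+v≰v : ∀ v → ¬ + 1 + (+ 1 + v) ≤ v
  2+v≰v v h = absurd 1 h (solve (v ∷ []))

  1+s≤y⇒1+y≢s : ∀ x y b → + 1 + (+ 1 + x - (+ 1 + b)) ≤ y → + 1 + y ≢ x - b
  1+s≤y⇒1+y≢s x y b s≤ eq = absurd 1 (s≤ ⊕ ≡⇒≤ eq) (solve (x ∷ y ∷ b ∷ []))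

  1+s≰s : ∀ x b → ¬ + 1 + (+ 1 + x - (+ 1 + b)) ≤ x - b
  1+s≰s x b s≤ = absurd 0 s≤ (solve (x ∷ b ∷ []))

  1+v≢v : ∀ v → + 1 + v ≢ v
  1+v≢v v h = absurd 0 (≡⇒≤ h) (solve (v ∷ []))

  shift-1 : ∀ x k → + 1 + x + k ≡ + 1 + (x + k)
  shift-1 = solve-∀

  module _ (G : Greedy) where
    open Greedy G

    Progress : List ℤ → Set
    Progress H = ∃ λ x → ∃ λ b → ∃ λ u → ∃ λ H' → State G x b u H' × length H' ℕ.< length H

    -- Rows used long ago may well be adjacent, so only rows from `W` on are watched, `W` lying
    -- above everything used at the start. As long as no hole is filled, such rows come from upward
    -- moves, at distance at least 2 from each other, or from downward moves, which land on the
    -- frontier and so outside the range of `spaced`. `top` keeps the next upward row from touching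
    -- the previous ones.
    record Gaps (W x b u : ℤ) : Set where
      field
        spaced : ∀ {y} → W ≤ y → + 1 + (x - b) ≤ y → Row x y → ¬ Row x (+ 1 + y)
        top    : ∀ {y} → W ≤ y → Row x y → + 2 + y ≤ x + u

    -- Both clauses are vacuous, all used rows being below `x + u`.
    gaps₀ : ∀ {x b u H} → State G x b u H → Gaps (x + u) x b u
    gaps₀ {x} {b} {u} st = record
      { spaced = λ {y} W≤ _ r _ → absurd 0 (W≤ ⊕ below r) (solve (x ∷ y ∷ u ∷ []))
      ; top    = λ {y} W≤ r → ⊥-elim (absurd 0 (W≤ ⊕ below r) (solve (x ∷ y ∷ u ∷ []))) }
      where open State st

    gaps-up : ∀ {W x b u H} → State G x b u H → Cell x (x + u) →
      Gaps W x b u → Gaps W (+ 1 + x) b (+ 1 + u)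
    gaps-up {W} {x} {b} {u} st c g = record { spaced = spaced′ ; top = top′ }
      where
      open State st
      open Gaps g
      spaced′ : ∀ {y} → W ≤ y → + 1 + (+ 1 + x - b) ≤ y → Row (+ 1 + x) y → ¬ Row (+ 1 + x) (+ 1 + y)
      spaced′ {y} W≤ s≤ r r⁺ = cases (row-step start c r) (row-step start c r⁺)
        where
        cases : Row x y ⊎ y ≡ x + u → ¬ (Row x (+ 1 + y) ⊎ + 1 + y ≡ x + u)
        cases (inj₁ q)    (inj₁ q⁺) = spaced W≤ (lin 1 s≤ (solve (x ∷ y ∷ b ∷ []))) q q⁺
        cases (inj₁ q)    (inj₂ eq) = 2+y≰1+y x y u (top W≤ q) eq
        cases (inj₂ refl) (inj₁ q⁺) = 2+v≰v (x + u) (below q⁺)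
        cases (inj₂ refl) (inj₂ eq) = 1+v≢v (x + u) eq
      top′ : ∀ {y} → W ≤ y → Row (+ 1 + x) y → + 2 + y ≤ + 1 + x + (+ 1 + u)
      top′ {y} W≤ r with row-step start c r
      ... | inj₁ q    = lin 2 (top W≤ q) (solve (x ∷ y ∷ u ∷ []))
      ... | inj₂ refl = lin 0 (≤-refl {x}) (solve (x ∷ u ∷ []))

    gaps-down : ∀ {W x b u H} → State G x b u H → Cell x (x - b) →
      Gaps W x b u → Gaps W (+ 1 + x) (+ 1 + b) u
    gaps-down {W} {x} {b} {u} st c g = record { spaced = spaced′ ; top = top′ }
      where
      open State st
      open Gaps g
      spaced′ : ∀ {y} → W ≤ y → + 1 + (+ 1 + x - (+ 1 + b)) ≤ y → Row (+ 1 + x) y → ¬ Row (+ 1 + x) (+ 1 + y)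
      spaced′ {y} W≤ s≤ r r⁺ = cases (row-step start c r) (row-step start c r⁺)
        where
        cases : Row x y ⊎ y ≡ x - b → ¬ (Row x (+ 1 + y) ⊎ + 1 + y ≡ x - b)
        cases (inj₁ q)    (inj₁ q⁺) = spaced W≤ (lin 0 s≤ (solve (x ∷ y ∷ b ∷ []))) q q⁺
        cases (inj₁ q)    (inj₂ eq) = 1+s≤y⇒1+y≢s x y b s≤ eq
        cases (inj₂ refl) _         = 1+s≰s x b s≤
      top′ : ∀ {y} → W ≤ y → Row (+ 1 + x) y → + 2 + y ≤ + 1 + x + u
      top′ {y} W≤ r with row-step start c r
      ... | inj₁ q    = lin 1 (top W≤ q) (solve (x ∷ y ∷ u ∷ []))
      ... | inj₂ refl = lin 0 wide (solve (x ∷ b ∷ u ∷ []))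

    -- An upward move past a vacant diagonal k needs row x + k to be used, and two in a row
    -- would need two adjacent used rows.
    ¬up-up : ∀ {W x b u H k} → State G x b u H → Gaps W x b u → k ∈ H → W ≤ x + k →
      Cell x (x + u) → Row x (x + k) → ¬ Row (+ 1 + x) (+ 1 + x + k)
    ¬up-up {W} {x} {b} {u} {k = k} st g k∈ W≤ c r r⁺ with row-step start c r⁺
      where open State st
    ... | inj₁ q  = spaced W≤ (lin 0 (proj₁ (proj₂ (vacant k∈))) (solve (x ∷ k ∷ b ∷ []))) r
                      (subst (Row x) (shift-1 x k) q)
      where
      open State st
      open Gaps g
    ... | inj₂ eq = 2+y≰1+y x (x + k) u (top W≤ r) (trans (sym (shift-1 x k)) eq)
      where open Gaps g

    -- The frontier x - b moves up by one at least every other column, until it meets the used row w.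
    module _ {W k : ℤ} {H : List ℤ} (z≤W : z ≤ W) (k∈ : k ∈ H) where

      descend : ∀ n {x b u w} → State G x b u H → Gaps W x b u → W ≤ x + k →
        Row x w → w ≡ x - b + + suc n → Progress H
      -- `st` and `g` describe the column before the upward move, since `¬up-up` reasons about the
      -- rows used there; `st′` is the state after it. In both functions `n` measures how far the
      -- frontier still is from `w`.
      after-up : ∀ n {x b u w} → State G x b u H → Gaps W x b u → W ≤ x + k →
        Cell x (x + u) → Row x (x + k) → State G (+ 1 + x) b (+ 1 + u) H →
        Row (+ 1 + x) w → w ≡ + 1 + x - b + + n → Progress H

      descend n {x} {b} {u} {w} st g W≤ rw w≡ with step G st
      ... | fill l st′ = _ , _ , _ , _ , st′ , l
      ... | up c _ r st′ = after-up n st g W≤ c (r k∈ (≤-trans z≤W W≤)) st′ (row-keep rw)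
                             (trans w≡ (lemma x b (+ n)))
        where
        lemma : ∀ x b n → x - b + (+ 1 + n) ≡ + 1 + x - b + n
        lemma = solve-∀
      ... | down c st′ with step G st′
      ... | fill l st″ = _ , _ , _ , _ , st″ , l
      -- The first downward move used the frontier row, and the frontier has not moved since.
      ... | down c′ _ = ⊥-elim (row-fresh (State.start st′) c′ (subst (Row _) (lemma x b) (row-new (State.start st) c)))
        where
        lemma : ∀ x b → x - b ≡ + 1 + x - (+ 1 + b)
        lemma = solve-∀
      ... | up c′ _ r st″ = after-up n st′ (gaps-down st c g) W≤′ c′
                              (r k∈ (≤-trans z≤W W≤′)) st″ (row-keep (row-keep rw)) (trans w≡ (lemma x b (+ n)))
        where
        W≤′ : W ≤ + 1 + x + k
        W≤′ = ≤-trans W≤ (lin 1 (≤-refl {x}) (solve (x ∷ k ∷ [])))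
        lemma : ∀ x b n → x - b + (+ 1 + n) ≡ + 1 + (+ 1 + x) - (+ 1 + b) + n
        lemma = solve-∀

      after-up (suc n) {x} st g W≤ c r st′ rw w≡ =
        descend n st′ (gaps-up st c g) (≤-trans W≤ (lin 1 (≤-refl {x}) (solve (x ∷ k ∷ [])))) rw w≡
      -- The frontier is now `w` itself: a downward move would reuse row `w`, and an upward one
      -- would be the second in succession. Only filling a hole is left.
      after-up zero {x} {b} {w = w} st g W≤ c r st′ rw w≡ with step G st′
      ... | fill l st″ = _ , _ , _ , _ , st″ , l
      ... | down c′ _ = ⊥-elim (row-fresh (State.start st′) c′ (subst (Row _) (trans w≡ (lemma x b)) rw))
        where
        lemma : ∀ x b → + 1 + x - b + + 0 ≡ + 1 + x - b
        lemma = solve-∀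
      ... | up _ _ r′ _ = ⊥-elim (¬up-up st g k∈ W≤ c r
          (r′ k∈ (≤-trans z≤W (≤-trans W≤ (lin 1 (≤-refl {x}) (solve (x ∷ k ∷ [])))))))

      -- Supplies the obstacle `w`. Two downward moves never follow each other, so unless a hole is
      -- filled an upward move occurs within two columns, and its row lies on or above the frontier
      -- reached after it.
      climb : ∀ {x b u} → State G x b u H → Gaps W x b u → W ≤ x + k → Progress H
      climb {x} {b} {u} st g W≤ with step G st
      ... | fill l st′ = _ , _ , _ , _ , st′ , l
      ... | up c _ r st′ = after-up ∣ b + u - + 1 ∣ st g W≤ c (r k∈ (≤-trans z≤W W≤)) st′
                             (row-new (State.start st) c) w≡
        where
        eq : + ∣ b + u - + 1 ∣ ≡ b + u - + 1
        eq = 0≤i⇒+∣i∣≡i (lin 0 (State.wide st) (solve (b ∷ u ∷ [])))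
        w≡ : x + u ≡ + 1 + x - b + + ∣ b + u - + 1 ∣
        w≡ rewrite eq = solve (x ∷ b ∷ u ∷ [])
      ... | down c st′ with step G st′
      ... | fill l st″ = _ , _ , _ , _ , st″ , l
      ... | down c′ _ = ⊥-elim (row-fresh (State.start st′) c′ (subst (Row _) (lemma x b) (row-new (State.start st) c)))
        where
        lemma : ∀ x b → x - b ≡ + 1 + x - (+ 1 + b)
        lemma = solve-∀
      ... | up c′ _ r st″ = after-up ∣ b + u ∣ st′ (gaps-down st c g) W≤′ c′
                              (r k∈ (≤-trans z≤W W≤′)) st″ (row-new (State.start st′) c′) w≡
        where
        W≤′ : W ≤ + 1 + x + k
        W≤′ = ≤-trans W≤ (lin 1 (≤-refl {x}) (solve (x ∷ k ∷ [])))
        eq : + ∣ b + u ∣ ≡ b + u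
        eq = 0≤i⇒+∣i∣≡i (lin 1 (State.wide st) (solve (b ∷ u ∷ [])))
        w≡ : + 1 + x + u ≡ + 1 + (+ 1 + x) - (+ 1 + b) + + ∣ b + u ∣
        w≡ rewrite eq = solve (x ∷ b ∷ u ∷ [])

      -- The row `x + k` in which the vacant diagonal meets the current column rises by one per
      -- column, while `W` is fixed; this waits until it enters the watched range.
      approach : ∀ n {x b u} → State G x b u H → Gaps W x b u → W ≤ x + k + + n → Progress H
      approach zero {x} st g W≤ = climb st g (≤-trans W≤ (lin 0 (≤-refl {x}) (solve (x ∷ k ∷ []))))
      approach (suc n) {x} st g W≤ with step G st
      ... | fill l st′ = _ , _ , _ , _ , st′ , l
      ... | up c _ _ st′ = approach n st′ (gaps-up st c g) (≤-trans W≤ (lin 0 (≤-refl {x}) (lemma x k (+ n))))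
        where
        lemma : ∀ x k n → + 1 + x + k + n - (x + k + (+ 1 + n)) ≡ x - x + + 0
        lemma = solve-∀
      ... | down c st′ = approach n st′ (gaps-down st c g) (≤-trans W≤ (lin 0 (≤-refl {x}) (lemma x k (+ n))))
        where
        lemma : ∀ x k n → + 1 + x + k + n - (x + k + (+ 1 + n)) ≡ x - x + + 0
        lemma = solve-∀

    progress : ∀ {x b u k H} → State G x b u (k ∷ H) → Progress (k ∷ H)
    progress {x} {b} {u} {k} st =
      approach (State.floor st) (here refl) ∣ u - k ∣ st (gaps₀ st) enough
      where
      enough : x + u ≤ x + k + + ∣ u - k ∣
      enough rewrite 0≤i⇒+∣i∣≡i (i≤j⇒0≤j-i (≤-trans (i≤suc[i] k) (proj₂ (proj₂ (State.vacant st (here refl)))))) =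
        lin 0 (≤-refl {x}) (solve (x ∷ u ∷ k ∷ []))

    settle : ∀ n {x b u} H → length H ℕ.≤ n → State G x b u H → ∃ λ x → ∃ λ b → ∃ λ u → State G x b u []
    settle n [] _ st = _ , _ , _ , st
    settle (suc n) (k ∷ H) (s≤s l) st with progress st
    ... | _ , _ , _ , H' , st′ , l′ = settle n H' (ℕ.≤-trans (ℕ.≤-pred l′) l) st′

-- The settled process: one phase per diagonal, and the recursion from counting rows.

module Phases where
  open import Data.Empty using (⊥-elim)
  open import Data.Integer using (ℤ; +_; _+_; _-_; -_; _≤_; _≟_; ∣_∣; +≤+; -≤+; -[1+_])
  open import Data.Integer.Properties using (≤-refl; ≤-trans; 0≤i⇒+∣i∣≡i; +-injective; ∣-i∣≡∣i∣; neg-involutive; neg-mono-≤; i≤j⇒0≤j-i)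
  open import Data.Integer.Tactic.RingSolver using (solve; solve-∀)
  import Data.Nat.Tactic.RingSolver as ℕSolver
  open import Data.List using (List; []; _∷_; _++_; filter)
  open import Data.List.Membership.Propositional using (_∈_)
  open import Data.List.Membership.Propositional.Properties using (∈-filter⁺; ∈-filter⁻; ∈-++⁺ˡ; ∈-++⁺ʳ)
  open import Data.List.Relation.Unary.Any using (here; there; any?)
  open import Data.Nat as ℕ using (ℕ; zero; suc; z≤n; s≤s; _∸_)
  import Data.Nat.Properties as ℕ
  open import Data.Product using (∃; _×_; _,_; proj₁; proj₂)
  open import Data.Sum using (_⊎_; inj₁; inj₂)
  open import Relation.Binary.PropositionalEquality hiding (J)
  open import Relation.Nullary using (¬_; yes; no; ¬?)
  open Linear
  open Counting
  open Settling
  open Filling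

  i≤∣i∣ : ∀ {i} → i ≤ + ∣ i ∣
  i≤∣i∣ {+ _}      = ≤-refl
  i≤∣i∣ { -[1+ _ ]} = -≤+

  bound : List ℤ → ℕ
  bound []       = 0
  bound (k ∷ ks) = ∣ k ∣ ℕ.+ bound ks

  ∣∣≤bound : ∀ {k ks} → k ∈ ks → ∣ k ∣ ℕ.≤ bound ks
  ∣∣≤bound {ks = k ∷ ks} (here refl) = ℕ.m≤m+n ∣ k ∣ (bound ks)
  ∣∣≤bound {ks = l ∷ ks} (there k∈)  = ℕ.≤-trans (∣∣≤bound k∈) (ℕ.m≤n+m (bound ks) ∣ l ∣)

  ≤bound : ∀ k ks → k ∈ ks → k ≤ + bound ks
  ≤bound k ks k∈ = ≤-trans i≤∣i∣ (+≤+ (∣∣≤bound k∈))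

  -bound≤ : ∀ k ks → k ∈ ks → - + bound ks ≤ k
  -bound≤ k ks k∈ = subst (- + bound ks ≤_) (neg-involutive k)
    (neg-mono-≤ (≤-trans i≤∣i∣ (+≤+ (subst (ℕ._≤ bound ks) (sym (∣-i∣≡∣i∣ k)) (∣∣≤bound k∈)))))

  -- A discrete intermediate value theorem, used to invert increasing functions.
  crossing : (g : ℕ → ℕ) (t n : ℕ) → g 0 ℕ.< t → t ℕ.≤ g n →
    ∃ λ m → suc m ℕ.≤ n × g m ℕ.< t × t ℕ.≤ g (suc m)
  crossing g t zero    lo hi = ⊥-elim (ℕ.<⇒≱ lo hi)
  crossing g t (suc n) lo hi with t ℕ.≤? g n
  ... | no  t≰ = n , ℕ.≤-refl , ℕ.≰⇒> t≰ , hi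
  ... | yes t≤ with crossing g t n lo t≤
  ... | m , m< , l , h = m , ℕ.m≤n⇒m≤1+n m< , l , h

  mono-steps : (g : ℕ → ℕ) → (∀ k → g k ℕ.< g (suc k)) → ∀ {k l} → k ℕ.< l → g k ℕ.< g l
  mono-steps g step {k} {suc l} (s≤s k≤l) with ℕ.m≤n⇒m<n∨m≡n k≤l
  ... | inj₁ k<l  = ℕ.<-trans (mono-steps g step k<l) (step l)
  ... | inj₂ refl = step k

  -- f j is the column of the cell on diagonal j.
  record Profile (Cell : ℤ → ℤ → Set) : Set where
    field
      J K   : ℕ
      f     : ℕ → ℕ
      mono  : ∀ {j} → J ℕ.≤ j → f j ℕ.< f (suc j)
      upper : ∀ {j} → J ℕ.≤ j → Cell (+ f j) (+ (f j ℕ.+ j))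
      lower : ∀ {j x} → J ℕ.≤ j → f j ℕ.< x → x ℕ.< f (suc j) → Cell (+ x) (+ j)
      recur : ∀ {j} → K ℕ.≤ j → ∃ λ i → J ℕ.≤ i × suc i ℕ.< j ×
              f j ℕ.+ suc i ≡ j ℕ.+ j × f i ℕ.+ i ℕ.< j × j ℕ.≤ f (suc i) ℕ.+ suc i

  module _ (G : Greedy) where
    open Greedy G

    private
      module D = Count diag-count
      module R = Count row-count

      -- `M` bounds `z` and all rows and diagonals used before column `d`. The interval is taken so
      -- wide that it contains every used diagonal, that `x + u` exceeds every used row, and,
      -- through the extra `d` in `b₀`, that the frontier is below `z`, so `filled` is vacuous. The
      -- price is a finite list of holes.
      used = z ∷ D.elements ++ R.elements
      M = + bound used
      u₀ = + 1 + M
      b₀ = + 1 + M + d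

      z≤M : z ≤ M
      z≤M = ≤bound z used (here refl)
      -M≤z : - M ≤ z
      -M≤z = -bound≤ z used (here refl)
      0≤M : + 0 ≤ M
      0≤M = +≤+ z≤n

      candidates = Count.elements (interval-length (+ 1 - b₀) ∣ b₀ + M ∣)
      used? = λ k → any? (k ≟_) D.elements
      H₀ = filter (λ k → ¬? (used? k)) candidates

      a₁ : ∀ m d → + 0 ≤ m → + 0 ≤ d → + 1 ≤ + 1 + m + d + (+ 1 + m)
      a₁ m d p q = lin 1 (p ⊕ p ⊕ q) (solve (m ∷ d ∷ []))
      a₂ : ∀ m d z → + 0 ≤ d → z ≤ m → z ≤ d + (+ 1 + m)
      a₂ m d z p q = lin 1 (p ⊕ q) (solve (m ∷ d ∷ z ∷ []))
      a₃ : ∀ m d k → + 0 ≤ d → - m ≤ k → + 1 - (+ 1 + m + d) ≤ k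
      a₃ m d k p q = lin 0 (p ⊕ q) (solve (m ∷ d ∷ k ∷ []))
      a₄ : ∀ m k → k ≤ m → + 1 + k ≤ + 1 + m
      a₄ m k p = lin 0 p (solve (m ∷ k ∷ []))
      a₅ : ∀ m d z y → z ≤ y → - m ≤ z → ¬ + 1 + y + (+ 1 + m + d) ≤ d
      a₅ m d z y p q r = absurd 1 (p ⊕ q ⊕ r) (solve (m ∷ d ∷ z ∷ y ∷ []))
      a₆ : ∀ m d y → + 0 ≤ d → y ≤ m → + 1 + y ≤ d + (+ 1 + m)
      a₆ m d y p q = lin 0 (p ⊕ q) (solve (m ∷ d ∷ y ∷ []))
      a₇ : ∀ m d → + 0 ≤ m → + 0 ≤ d → + 0 ≤ + 1 + m + d + m
      a₇ m d p q = lin 1 (p ⊕ p ⊕ q) (solve (m ∷ d ∷ []))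
      a₈ : ∀ m b → + 1 - b + (b + m) ≡ + 1 + m
      a₈ = solve-∀

      top≡ : + 1 - b₀ + + ∣ b₀ + M ∣ ≡ u₀
      top≡ = trans (cong (λ k → + 1 - b₀ + k) (0≤i⇒+∣i∣≡i (a₇ M d 0≤M d-nonneg))) (a₈ M b₀)

    initial : State G d b₀ u₀ H₀
    initial = record
      { start  = ≤-refl
      ; pos    = +≤+ z≤n
      ; wide   = a₁ M d 0≤M d-nonneg
      ; floor  = a₂ M d z d-nonneg z≤M
      ; inner  = λ {k} g → let k∈ = there (∈-++⁺ˡ (D.complete g)) in
                   a₃ M d k d-nonneg (-bound≤ k used k∈) , a₄ M k (≤bound k used k∈)
      ; filled = λ {y} z≤y h → ⊥-elim (a₅ M d z y z≤y -M≤z h)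
      ; below  = λ {y} r → a₆ M d y d-nonneg (≤bound y used (there (∈-++⁺ʳ D.elements (R.complete r))))
      ; holes  = holes′
      ; vacant = vacant′
      ; rows   = row-count
      ; diags  = diag-count
      }
      where
      holes′ : ∀ {k} → + 1 - b₀ ≤ k → + 1 + k ≤ u₀ → Diag d k ⊎ k ∈ H₀
      holes′ {k} l h with used? k
      ... | yes k∈ = inj₁ (D.sound k∈)
      ... | no k∉  = inj₂ (∈-filter⁺ (λ k → ¬? (used? k))
                       (Count.complete (interval-length _ _) (l , subst (+ 1 + k ≤_) (sym top≡) h)) k∉)
      vacant′ : ∀ {k} → k ∈ H₀ → ¬ Diag d k × + 1 - b₀ ≤ k × + 1 + k ≤ u₀
      vacant′ {k} k∈ with ∈-filter⁻ (λ k → ¬? (used? k)) k∈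
      ... | k∈c , k∉ with Count.sound (interval-length _ _) k∈c
      ... | l , h = (λ g → k∉ (D.complete g)) , l , subst (+ 1 + k ≤_) top≡ h

    -- Without holes the used diagonals are exactly the `b + u - 1` integers strictly between `- b`
    -- and `u`, and they number `x`.
    width : ∀ {x b u} → State G x b u [] → b + u ≡ + 1 + x
    width {x} {b} {u} st = trans (e₂ b u) (cong (λ k → + 1 + k) (Count-unique counted diags
        (λ (l , h) → vacuous (holes l (subst (_ ≤_) eq h)))
        (λ g → proj₁ (inner g) , subst (_ ≤_) (sym eq) (proj₂ (inner g)))))
      where
      open State st
      n = ∣ b + u - + 1 ∣
      n≡ : + n ≡ b + u - + 1
      n≡ = 0≤i⇒+∣i∣≡i (lin 0 wide (solve (b ∷ u ∷ [])))
      e₁ : ∀ b u → + 1 - b + (b + u - + 1) ≡ u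
      e₁ = solve-∀
      e₂ : ∀ b u → b + u ≡ + 1 + (b + u - + 1)
      e₂ = solve-∀
      eq : + 1 - b + + n ≡ u
      eq = trans (cong (λ k → + 1 - b + k) n≡) (e₁ b u)
      counted : Count (Interval (+ 1 - b) (+ 1 - b + + n)) (b + u - + 1)
      counted = subst (Count _) n≡ (interval-length (+ 1 - b) n)
      vacuous : ∀ {k} → Diag x k ⊎ k ∈ [] → Diag x k
      vacuous (inj₁ g) = g

    -- Downward moves thus land in the row numbered one less than the next upper diagonal, which is
    -- what lets `f` describe the lower cells as well.
    frontier : ∀ {x b u} → State G x b u [] → x - b ≡ u - + 1
    frontier {x} {b} {u} st = e (width st)
      where
      e : b + u ≡ + 1 + x → x - b ≡ u - + 1
      e eq = ≤-both (lin 0 (≡⇒≤ (sym eq)) (solve (x ∷ b ∷ u ∷ []))) (lin 0 (≡⇒≤ eq) (solve (x ∷ b ∷ u ∷ [])))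

    -- The columns from `X` until diagonal `j` is used: at most one downward move, into row `j - 1`,
    -- and then the upward move in column `p`.
    record Phase (X j : ℕ) : Set where
      field
        p       : ℕ
        after   : X ℕ.≤ p
        above   : Cell (+ p) (+ (p ℕ.+ j))
        beneath : ∀ {x} → X ℕ.≤ x → x ℕ.< p → Cell (+ x) (+ j - + 1)
        {b}     : ℤ
        next    : State G (+ suc p) b (+ suc j) []
        keep    : ∀ {y} → Row (+ X) y → Row (+ suc p) y
        new     : ∀ {y} → Row (+ suc p) y → Row (+ X) y ⊎ + 1 + y ≤ + j ⊎ y ≡ + (p ℕ.+ j)

    phase : ∀ {X b j} → State G (+ X) b (+ j) [] → Phase X j
    phase {X} {b} {j} st with step G st
    ... | up c _ _ st′ = record
        { p       = X
        ; after   = ℕ.≤-refl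
        ; above   = c
        ; beneath = λ X≤x x<X → ⊥-elim (ℕ.<⇒≱ x<X X≤x)
        ; next    = st′
        ; keep    = row-keep
        ; new     = new′
        }
      where
      new′ : ∀ {y} → Row (+ suc X) y → Row (+ X) y ⊎ + 1 + y ≤ + j ⊎ y ≡ + (X ℕ.+ j)
      new′ r with row-step (State.start st) c r
      ... | inj₁ r′ = inj₁ r′
      ... | inj₂ eq = inj₂ (inj₂ eq)
    ... | down c st′ with step G st′
    ... | down c′ _ = ⊥-elim (row-fresh (State.start st′) c′ (subst (Row _) (lemma (+ X) b) (row-new (State.start st) c)))
        where
        lemma : ∀ x b → x - b ≡ + 1 + x - (+ 1 + b)
        lemma = solve-∀
    ... | up c′ _ _ st″ = record
        { p       = suc X
        ; after   = ℕ.n≤1+n X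
        ; above   = c′
        ; beneath = λ X≤x x≤X → subst (λ x → Cell (+ x) _) (ℕ.≤-antisym X≤x (ℕ.≤-pred x≤X))
                                  (subst (Cell (+ X)) (frontier st) c)
        ; next    = st″
        ; keep    = λ r → row-keep (row-keep r)
        ; new     = new′
        }
      where
      lemma : ∀ j → + 1 + (j - + 1) ≡ j
      lemma = solve-∀
      new′ : ∀ {y} → Row (+ suc (suc X)) y → Row (+ X) y ⊎ + 1 + y ≤ + j ⊎ y ≡ + (suc X ℕ.+ j)
      new′ r with row-step (State.start st′) c′ r
      ... | inj₂ eq = inj₂ (inj₂ eq)
      ... | inj₁ r′ with row-step (State.start st) c r′
      ... | inj₁ r″   = inj₁ r″
      ... | inj₂ refl = inj₂ (inj₁ (≡⇒≤ (trans (cong (λ k → + 1 + k) (frontier st)) (lemma (+ j)))))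

    module Sequence {X₀ b₀ J} (st₀ : State G (+ X₀) b₀ (+ J) []) where
      open Phase using (p; after; above; beneath; next; keep; new)

      states : ∀ n → ∃ λ X → ∃ λ b → State G (+ X) b (+ (n ℕ.+ J)) []
      states zero    = X₀ , b₀ , st₀
      states (suc n) = _ , _ , next (phase (proj₂ (proj₂ (states n))))

      π : ℕ → ℕ
      π n = proj₁ (states n)

      at : ∀ n → State G (+ π n) (proj₁ (proj₂ (states n))) (+ (n ℕ.+ J)) []
      at n = proj₂ (proj₂ (states n))

      ph : ∀ n → Phase (π n) (n ℕ.+ J)
      ph n = phase (at n)

      col row : ℕ → ℕ
      col n = p (ph n)
      row n = col n ℕ.+ (n ℕ.+ J)

      col-mono : ∀ n → col n ℕ.< col (suc n)
      col-mono n = after (ph (suc n))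

      row-mono : ∀ n → row n ℕ.< row (suc n)
      row-mono n = ℕ.+-mono-<-≤ (col-mono n) (ℕ.n≤1+n (n ℕ.+ J))

      n≤col : ∀ n → n ℕ.≤ col n
      n≤col zero    = z≤n
      n≤col (suc n) = ℕ.≤-<-trans (n≤col n) (col-mono n)

      row-used : ∀ {k} n → k ℕ.< n → Row (+ π n) (+ row k)
      row-used (suc n) (s≤s k≤n) with ℕ.m≤n⇒m<n∨m≡n k≤n
      ... | inj₁ k<n  = keep (ph n) (row-used n k<n)
      ... | inj₂ refl = row-new start above′
        where
        start : d ≤ + col n
        start = ≤-trans (State.start (at n)) (+≤+ (after (ph n)))
        above′ : Cell (+ col n) (+ row n)
        above′ = above (ph n)

      -- The three sources of used rows are the columns before the sequence, the downward moves and
      -- the upward moves.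
      row-history : ∀ n {y} → Row (+ π (suc n)) y →
        + 1 + y ≤ + (π 0 ℕ.+ J) ⊎ + 1 + y ≤ + (n ℕ.+ J) ⊎ (∃ λ k → k ℕ.≤ n × y ≡ + row k)
      row-history n r with new (ph n) r
      ... | inj₂ (inj₁ h)  = inj₂ (inj₁ h)
      ... | inj₂ (inj₂ eq) = inj₂ (inj₂ (n , ℕ.≤-refl , eq))
      row-history zero    r | inj₁ r′ = inj₁ (State.below st₀ r′)
      row-history (suc n) r | inj₁ r′ with row-history n r′
      ... | inj₁ h                     = inj₁ h
      ... | inj₂ (inj₁ h)              = inj₂ (inj₁ (≤-trans h (+≤+ (ℕ.n≤1+n (n ℕ.+ J)))))
      ... | inj₂ (inj₂ (k , k≤n , eq)) = inj₂ (inj₂ (k , ℕ.m≤n⇒m≤1+n k≤n , eq))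

      -- The shape of the used rows after a phase: a solid block from `z` up to the frontier `s`,
      -- and above it the isolated rows of upward moves that the frontier has not yet reached.
      Band : ℕ → ℤ → ℕ → ℤ → Set
      Band m s k y = Interval z s y ⊎ ∃ λ l → m ℕ.≤ l × l ℕ.< k × y ≡ + row l

      band-count : ∀ {m s} r → z ≤ s → s ≤ + row m → Count (Band m s (r ℕ.+ m)) (+ r + (s - z))
      band-count {m} {s} zero z≤s _ = record
        { elements = elements
        ; unique   = unique
        ; sound    = λ k∈ → let (l , h) = sound k∈ in inj₁ (l , subst (_ ≤_) eq h)
        ; complete = complete′
        ; size     = trans size (trans n≡ (0+ (s - z)))
        }
        where
        n = ∣ s - z ∣
        n≡ : + n ≡ s - z
        n≡ = 0≤i⇒+∣i∣≡i (i≤j⇒0≤j-i z≤s)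
        0+ : ∀ k → k ≡ + 0 + k
        0+ = solve-∀
        z+[s-z] : ∀ z s → z + (s - z) ≡ s
        z+[s-z] = solve-∀
        eq : z + + n ≡ s
        eq = trans (cong (λ k → z + k) n≡) (z+[s-z] z s)
        open Count (interval-length z n)
        complete′ : ∀ {y} → Band m s m y → y ∈ elements
        complete′ (inj₁ (l , h)) = complete (l , subst (_ ≤_) (sym eq) h)
        complete′ (inj₂ (l , m≤l , l<m , _)) = ⊥-elim (ℕ.<⇒≱ l<m m≤l)
      band-count {m} {s} (suc r) z≤s s≤ = subst (Count _) (assoc (+ r) (s - z))
        (Count-add (+ row (r ℕ.+ m)) (band-count r z≤s s≤) fresh
          (inj₂ (r ℕ.+ m , ℕ.m≤n+m m r , ℕ.≤-refl , refl)) old split)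
        where
        assoc : ∀ r k → + 1 + (r + k) ≡ + 1 + r + k
        assoc = solve-∀
        1+y≰y : ∀ y s → s ≤ y → ¬ + 1 + y ≤ s
        1+y≰y y s h h′ = absurd 0 (h ⊕ h′) (solve (y ∷ s ∷ []))
        s≤row : ∀ l → m ℕ.≤ l → s ≤ + row l
        s≤row l m≤l with ℕ.m≤n⇒m<n∨m≡n m≤l
        ... | inj₁ m<l  = ≤-trans s≤ (+≤+ (ℕ.<⇒≤ (mono-steps row row-mono m<l)))
        ... | inj₂ refl = s≤
        fresh : ¬ Band m s (r ℕ.+ m) (+ row (r ℕ.+ m))
        fresh (inj₁ (_ , h))          = 1+y≰y _ s (s≤row (r ℕ.+ m) (ℕ.m≤n+m m r)) h
        fresh (inj₂ (l , _ , l< , eq)) = ℕ.<⇒≢ (mono-steps row row-mono l<) (sym (+-injective eq))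
        old : ∀ {y} → Band m s (r ℕ.+ m) y → Band m s (suc r ℕ.+ m) y
        old (inj₁ i)                  = inj₁ i
        old (inj₂ (l , m≤l , l< , eq)) = inj₂ (l , m≤l , ℕ.m≤n⇒m≤1+n l< , eq)
        split : ∀ {y} → Band m s (suc r ℕ.+ m) y → Band m s (r ℕ.+ m) y ⊎ y ≡ + row (r ℕ.+ m)
        split (inj₁ i) = inj₁ (inj₁ i)
        split (inj₂ (l , m≤l , s≤s l≤ , eq)) with ℕ.m≤n⇒m<n∨m≡n l≤
        ... | inj₁ l<   = inj₁ (inj₂ (l , m≤l , l< , eq))
        ... | inj₂ refl = inj₂ eq

      -- `row 0` and `∣ z ∣` make the diagonal index exceed `z` and every row used before the
      -- sequence; the 2 leaves a predecessor `n` with `1 ≤ col n`, which the search in `recurrence`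
      -- needs at its upper end.
      N : ℕ
      N = 2 ℕ.+ row 0 ℕ.+ ∣ z ∣

      -- Put j = n + J. After the phase of diagonal j, `1 + col n - z` rows are used: the `j - z`
      -- rows from `z` to the frontier j, and the upward rows of phases m + 1 to n, which are those
      -- not below j. Hence `1 + col n = (n - m) + j`, and adding m + J gives the equation.
      recurrence : ∀ {n} → N ℕ.≤ n → ∃ λ m → suc m ℕ.< n ×
        col n ℕ.+ (suc m ℕ.+ J) ≡ (n ℕ.+ J) ℕ.+ (n ℕ.+ J) × row m ℕ.< n ℕ.+ J × n ℕ.+ J ℕ.≤ row (suc m)
      recurrence {suc n} (s≤s N≤) with crossing row (suc n ℕ.+ J) n
          (ℕ.≤-trans (s≤s (ℕ.≤-trans (ℕ.m≤m+n (row 0) ∣ z ∣) (ℕ.≤-trans (ℕ.n≤1+n _) N≤))) (ℕ.m≤m+n (suc n) J))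
          (ℕ.+-monoˡ-≤ (n ℕ.+ J) (ℕ.≤-trans (ℕ.≤-trans (s≤s z≤n) N≤) (n≤col n)))
      ... | m , m<n , lo , hi = m , s≤s m<n , counted , lo , hi
        where
        s = + (suc n ℕ.+ J)
        r = suc n ∸ m
        r+m : r ℕ.+ suc m ≡ suc (suc n)
        r+m = trans (ℕ.+-suc r m) (cong suc (ℕ.m∸n+n≡m (ℕ.≤-trans (ℕ.n≤1+n m) (ℕ.m≤n⇒m≤1+n m<n))))
        z≤s : z ≤ s
        z≤s = ≤-trans i≤∣i∣ (+≤+ (ℕ.≤-trans (ℕ.m≤n+m ∣ z ∣ (suc (row 0)))
                (ℕ.≤-trans N≤ (ℕ.≤-trans (ℕ.n≤1+n n) (ℕ.m≤m+n (suc n) J)))))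
        row₀<s : row 0 ℕ.< suc n ℕ.+ J
        row₀<s = ℕ.≤-trans (s≤s (ℕ.≤-trans (ℕ.m≤m+n (row 0) ∣ z ∣) (ℕ.≤-trans (ℕ.n≤1+n _) N≤))) (ℕ.m≤m+n (suc n) J)
        into : ∀ {y} → Row (+ π (suc (suc n))) y → Band (suc m) s (r ℕ.+ suc m) y
        into {y} ry with row-history (suc n) ry
        ... | inj₁ h = inj₁ (row-floor ry , ≤-trans h (+≤+ (ℕ.≤-trans (ℕ.+-monoˡ-≤ J (after (ph 0))) (ℕ.<⇒≤ row₀<s))))
        ... | inj₂ (inj₁ h) = inj₁ (row-floor ry , h)
        ... | inj₂ (inj₂ (k , k≤ , refl)) with suc m ℕ.≤? k
        ... | yes m<k = inj₂ (k , m<k , subst (k ℕ.<_) (sym r+m) (s≤s k≤) , refl)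
        ... | no m≮k = inj₁ (row-floor ry , +≤+ (ℕ.≤-<-trans row-k≤ lo))
          where
          row-k≤ : row k ℕ.≤ row m
          row-k≤ with ℕ.m≤n⇒m<n∨m≡n (ℕ.≤-pred (ℕ.≰⇒> m≮k))
          ... | inj₁ k<m  = ℕ.<⇒≤ (mono-steps row row-mono k<m)
          ... | inj₂ refl = ℕ.≤-refl
        fill-low : ∀ x b s → b + (+ 1 + s) ≡ + 1 + x → ∀ y → + 1 + y ≤ s → + 1 + y + b ≤ x
        fill-low x b s eq y h = lin 0 (h ⊕ ≡⇒≤ eq) (solve (x ∷ b ∷ s ∷ y ∷ []))
        out : ∀ {y} → Band (suc m) s (r ℕ.+ suc m) y → Row (+ π (suc (suc n))) y
        out {y} (inj₁ (l , h)) = State.filled (at (suc (suc n))) l (fill-low _ _ s (width (at (suc (suc n)))) y h)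
        out (inj₂ (l , _ , l< , refl)) = row-used (suc (suc n)) (subst (l ℕ.<_) r+m l<)
        balance : ∀ c s r z → + 1 + c - z ≡ r + (s - z) → + 1 + c ≡ r + s
        balance c s r z eq = ≤-both (lin 0 (≡⇒≤ eq) (solve (c ∷ s ∷ r ∷ z ∷ []))) (lin 0 (≡⇒≤ (sym eq)) (solve (c ∷ s ∷ r ∷ z ∷ [])))
        total : suc (col (suc n)) ≡ r ℕ.+ (suc n ℕ.+ J)
        total = +-injective (balance (+ col (suc n)) s (+ r) z
          (Count-unique (State.rows (at (suc (suc n)))) (band-count r z≤s (+≤+ hi)) into out))
        counted : col (suc n) ℕ.+ (suc m ℕ.+ J) ≡ (suc n ℕ.+ J) ℕ.+ (suc n ℕ.+ J)
        counted = begin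
          col (suc n) ℕ.+ (suc m ℕ.+ J)               ≡⟨ ℕ.+-suc (col (suc n)) (m ℕ.+ J) ⟩
          suc (col (suc n)) ℕ.+ (m ℕ.+ J)             ≡⟨ cong (ℕ._+ (m ℕ.+ J)) total ⟩
          r ℕ.+ (suc n ℕ.+ J) ℕ.+ (m ℕ.+ J)           ≡⟨ rearrange r (suc n) m J ⟩
          (r ℕ.+ m ℕ.+ J) ℕ.+ (suc n ℕ.+ J)           ≡⟨ cong (λ k → k ℕ.+ J ℕ.+ (suc n ℕ.+ J)) (ℕ.suc-injective (trans (sym (ℕ.+-suc r m)) r+m)) ⟩
          (suc n ℕ.+ J) ℕ.+ (suc n ℕ.+ J)             ∎
          where
          open ≡-Reasoning
          rearrange : ∀ r n m J → r ℕ.+ (n ℕ.+ J) ℕ.+ (m ℕ.+ J) ≡ (r ℕ.+ m ℕ.+ J) ℕ.+ (n ℕ.+ J)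
          rearrange = ℕSolver.solve-∀

      private
        from : ∀ {j} → J ℕ.≤ j → ∃ λ n → n ℕ.+ J ≡ j
        from {j} J≤j = j ∸ J , ℕ.m∸n+n≡m J≤j

        f : ℕ → ℕ
        f j = col (j ∸ J)

        f≡ : ∀ n → f (n ℕ.+ J) ≡ col n
        f≡ n = cong col (ℕ.m+n∸n≡m n J)

      profile : Profile Cell
      profile = record { J = J ; K = N ℕ.+ J ; f = f ; mono = mono′ ; upper = upper′ ; lower = lower′ ; recur = recur′ }
        where
        mono′ : ∀ {j} → J ℕ.≤ j → f j ℕ.< f (suc j)
        mono′ J≤j with from J≤j
        ... | n , refl rewrite f≡ n | f≡ (suc n) = col-mono n
        upper′ : ∀ {j} → J ℕ.≤ j → Cell (+ f j) (+ (f j ℕ.+ j))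
        upper′ J≤j with from J≤j
        ... | n , refl rewrite f≡ n = above (ph n)
        lower′ : ∀ {j x} → J ℕ.≤ j → f j ℕ.< x → x ℕ.< f (suc j) → Cell (+ x) (+ j)
        lower′ J≤j l h with from J≤j
        ... | n , refl rewrite f≡ n | f≡ (suc n) = beneath (ph (suc n)) l h
        recur′ : ∀ {j} → N ℕ.+ J ℕ.≤ j → ∃ λ i → J ℕ.≤ i × suc i ℕ.< j ×
          f j ℕ.+ suc i ≡ j ℕ.+ j × f i ℕ.+ i ℕ.< j × j ℕ.≤ f (suc i) ℕ.+ suc i
        recur′ {j} NJ≤j with from (ℕ.m+n≤o⇒n≤o N NJ≤j)
        ... | n , refl with recurrence (ℕ.+-cancelʳ-≤ J N n NJ≤j)
        ... | m , m<n , eq , lo , hi rewrite f≡ n = m ℕ.+ J , ℕ.m≤n+m J m , ℕ.+-monoˡ-≤ J m<n , eq , lo′ , hi′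
          where
          lo′ : f (m ℕ.+ J) ℕ.+ (m ℕ.+ J) ℕ.< n ℕ.+ J
          lo′ rewrite f≡ m = lo
          hi′ : n ℕ.+ J ℕ.≤ f (suc m ℕ.+ J) ℕ.+ (suc m ℕ.+ J)
          hi′ rewrite f≡ (suc m) = hi

    profile : Profile Cell
    profile with settle G _ H₀ ℕ.≤-refl initial
    ... | + _ , _ , + _ , st = Sequence.profile st
    ... | + _ , _ , -[1+ _ ] , st with State.pos st
    ... | ()
    profile | -[1+ _ ] , _ , _ , st with ≤-trans d-nonneg (State.start st)
    ... | ()

-- Comparison of two solutions of the recursion.

module Compare where
  open import Data.Empty using (⊥-elim)
  open import Data.Integer using (ℤ; +_)
  open import Data.List using (List; _++_; length; map; upTo)
  open import Data.List.Membership.Propositional using (_∈_)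
  open import Data.List.Membership.Propositional.Properties using (∈-++⁺ˡ; ∈-++⁺ʳ; ∈-map⁺; ∈-upTo⁺)
  open import Data.List.Properties using (length-++; length-map; length-upTo)
  open import Data.Nat
  open import Data.Nat.Induction using (<-rec)
  open import Data.Nat.Properties
  open import Data.Nat.Tactic.RingSolver using (solve-∀)
  open import Data.Product using (∃; _×_; _,_; proj₁; proj₂)
  open import Data.Sum using (_⊎_; inj₁; inj₂)
  open import Function using (_∘_)
  open import Relation.Binary.Definitions using (tri<; tri≈; tri>)
  open import Relation.Binary.PropositionalEquality hiding (J)
  open import Relation.Nullary using (yes; no)
  open Phases

  -- f is a tail of a solution of f j = 2 j - min { i | j ≤ f i + i }.
  record Recursive (J K : ℕ) (f : ℕ → ℕ) : Set where
    field
      mono  : ∀ {j} → J ≤ j → f j < f (suc j)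
      recur : ∀ {j} → K ≤ j → ∃ λ i → J ≤ i × suc i < j ×
              f j + suc i ≡ j + j × f i + i < j × j ≤ f (suc i) + suc i

    mono≤ : ∀ {i j} → J ≤ i → i ≤ j → f i ≤ f j
    mono≤ {i} {j} J≤i i≤j with m≤n⇒m<n∨m≡n i≤j
    ... | inj₂ refl = ≤-refl
    mono≤ {i} {suc j} J≤i i≤j | inj₁ (s≤s i≤j′) =
      ≤-trans (mono≤ J≤i i≤j′) (<⇒≤ (mono (≤-trans J≤i i≤j′)))

    expand : ∀ {i} s → J ≤ i → f i + s ≤ f (i + s)
    expand {i} zero    J≤i = ≤-reflexive (trans (+-identityʳ (f i)) (cong f (sym (+-identityʳ i))))
    expand {i} (suc s) J≤i rewrite +-suc (f i) s | +-suc i s =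
      ≤-<-trans (expand s J≤i) (mono (≤-trans J≤i (m≤m+n i s)))

    j<f : ∀ {j} → K ≤ j → j < f j
    j<f {j} K≤j with recur K≤j
    ... | i , _ , i<j , eq , _ = +-cancelʳ-< j j (f j) (subst (_< f j + j) eq (+-monoʳ-< (f j) i<j))

    -- Carries statements about all large arguments from `j` to the index `i` in its recursion: the
    -- index tends to infinity with `j`.
    late : ∀ N {i j} → J ≤ N → J ≤ i → f N + N < j → j ≤ f (suc i) + suc i → N ≤ i
    late N {i} J≤N J≤i N< j≤ with N ≤? i
    ... | yes N≤i = N≤i
    ... | no  N≰i = ⊥-elim (<⇒≱ N< (≤-trans j≤ (+-mono-≤ (mono≤ (m≤n⇒m≤1+n J≤i) (≰⇒> N≰i)) (≰⇒> N≰i))))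

  abstract
    -- Two solutions are compared from a common start. Raising `J` requires raising `K` until the
    -- index in the recursion stays beyond the new start.
    restrict : ∀ {J K f} J′ → J ≤ J′ → Recursive J K f → ∃ λ K′ → ∀ {K″} → K′ ≤ K″ → Recursive J′ K″ f
    restrict {J} {K} {f} J′ J≤J′ r = K ⊔ suc (f J′ + J′) , λ K′≤ → record
      { mono  = λ J′≤j → mono (≤-trans J≤J′ J′≤j)
      ; recur = λ K″≤j → let K′≤j = ≤-trans K′≤ K″≤j
                             (i , J≤i , i<j , eq , lo , hi) = recur (≤-trans (m≤m⊔n K _) K′≤j)
                         in i , late J′ J≤J′ J≤i (≤-trans (m≤n⊔m K _) K′≤j) hi , i<j , eq , lo , hi
      }
      where open Recursive r

  module _ {J K f h} (F : Recursive J K f) (H : Recursive J K h) where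
    private
      module F = Recursive F
      module H = Recursive H

    -- The deviation of the two indices i is at most half the deviation of f and h there,
    -- because h i + i increases by at least 2 at each step.
    halve : ∀ {j i E} s → K ≤ j → J ≤ i → f j + suc i ≡ j + j → j ≤ f (suc i) + suc i →
      f (suc i) ≤ h (suc i) + E → E ≤ s + s → f j ≤ h j + s
    halve {j} {i} {E} s K≤j J≤i eq hi dev E≤ with f j ≤? h j + s
    ... | yes le = le
    ... | no ¬le with H.recur K≤j
    ... | i* , _ , _ , eq* , lo* , _ = ⊥-elim (n≮n _ (begin-strict
      h (suc i) + s + (suc i + s)   ≤⟨ +-monoˡ-≤ (suc i + s) (H.expand s (m≤n⇒m≤1+n J≤i)) ⟩
      h (suc i + s) + (suc i + s)   ≤⟨ +-mono-≤ (H.mono≤ (≤-trans J≤i (≤-trans (n≤1+n i) (m≤m+n (suc i) s))) far) far ⟩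
      h i* + i*                     <⟨ lo* ⟩
      j                             ≤⟨ hi ⟩
      f (suc i) + suc i             ≤⟨ +-monoˡ-≤ (suc i) dev ⟩
      h (suc i) + E + suc i         ≤⟨ +-monoˡ-≤ (suc i) (+-monoʳ-≤ (h (suc i)) E≤) ⟩
      h (suc i) + (s + s) + suc i   ≡⟨ swap (h (suc i)) s (suc i) ⟩
      h (suc i) + s + (suc i + s)   ∎))
      where
      open ≤-Reasoning
      swap : ∀ a s i → a + (s + s) + i ≡ a + s + (i + s)
      swap = solve-∀
      swap′ : ∀ a s i → suc (a + s) + i ≡ a + suc (i + s)
      swap′ = solve-∀
      far : suc i + s ≤ i*
      far = ≤-pred (+-cancelˡ-≤ (h j) _ _ (begin
        h j + suc (suc i + s)   ≡⟨ swap′ (h j) s (suc i) ⟨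
        suc (h j + s) + suc i   ≤⟨ +-monoˡ-≤ (suc i) (≰⇒> ¬le) ⟩
        f j + suc i             ≡⟨ trans eq (sym eq*) ⟩
        h j + suc i*            ∎))

    sum-below : ℕ → ℕ
    sum-below zero    = 0
    sum-below (suc n) = f n + sum-below n

    ≤sum-below : ∀ {n j} → j < n → f j ≤ sum-below n
    ≤sum-below {suc n} (s≤s j≤n) with m≤n⇒m<n∨m≡n j≤n
    ... | inj₁ j<n  = ≤-trans (≤sum-below j<n) (m≤n+m _ (f n))
    ... | inj₂ refl = m≤m+n (f n) _

    -- The starting value of the contraction. `halve` never enlarges a bound, so one that covers the
    -- finitely many `j` below `K` persists.
    bounded : ∀ j → f j ≤ h j + sum-below K
    bounded = <-rec _ λ j rec → go j rec
      where
      go : ∀ j → (∀ {i} → i < j → f i ≤ h i + sum-below K) → f j ≤ h j + sum-below K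
      go j rec with K ≤? j
      ... | no  K≰j = ≤-trans (≤sum-below (≰⇒> K≰j)) (m≤n+m _ (h j))
      ... | yes K≤j with F.recur K≤j
      ... | i , J≤i , i<j , eq , _ , hi = halve (sum-below K) K≤j J≤i eq hi (rec i<j) (m≤m+n _ _)

    -- `halve` takes `E + 2` to `E + 1`, as `E + 2 ≤ (E + 1) + (E + 1)`, but it cannot take 1 to 0,
    -- so the descent stops at 1. Each round raises the threshold so that the index of the recursion
    -- lies beyond the old one.
    near : ∀ E N → J ≤ N → (∀ {j} → N ≤ j → f j ≤ h j + E) → ∃ λ N → J ≤ N × (∀ {j} → N ≤ j → f j ≤ h j + 1)
    near zero          N J≤N dev = N , J≤N , λ {j} N≤j → ≤-trans (dev N≤j) (+-monoʳ-≤ (h j) z≤n)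
    near (suc zero)    N J≤N dev = N , J≤N , dev
    near (suc (suc E)) N J≤N dev = near (suc E) N′ (≤-trans J≤N N≤N′) dev′
      where
      N′ = N + K + suc (f N + N)
      N≤N′ : N ≤ N′
      N≤N′ = ≤-trans (m≤m+n N K) (m≤m+n (N + K) _)
      dev′ : ∀ {j} → N′ ≤ j → f j ≤ h j + suc E
      dev′ {j} N′≤j with ≤-trans (≤-trans (m≤n+m K N) (m≤m+n (N + K) _)) N′≤j
      ... | K≤j with F.recur K≤j
      ... | i , J≤i , i<j , eq , _ , hi =
        halve (suc E) K≤j J≤i eq hi (dev (m≤n⇒m≤1+n (F.late N J≤N J≤i (≤-trans (m≤n+m _ (N + K)) N′≤j) hi)))
              (s≤s (m≤n+m (suc E) E))

    Near : Set
    Near = ∃ λ N → J ≤ N × (∀ {j} → N ≤ j → f j ≤ h j + 1)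

    abstract
      is-near : Near
      is-near = near (sum-below K) J ≤-refl (λ {j} _ → bounded j)

    abstract
      -- Both recursions at `j` sum to `j + j`, so `h j < f j` makes the index of `h` the larger
      -- one. With `i` the upper index for `f` this gives `h i + i < j ≤ f i + i`; as the outer
      -- terms differ by at most 1, `j` equals the right one. `i + i ≤ j` follows from `i < f i`.
      ancestor : ∃ λ N → ∀ {j} → N ≤ j → h j < f j → ∃ λ i → j ≡ f i + i × h i < f i × i + i ≤ j
      ancestor with is-near
      ... | N , J≤N , close = N′ , anc
        where
        N₁ N′ : ℕ
        N₁ = N + K
        N′ = K + suc (f N₁ + N₁)
        anc : ∀ {j} → N′ ≤ j → h j < f j → ∃ λ i → j ≡ f i + i × h i < f i × i + i ≤ j
        anc {j} N′≤j h<f with ≤-trans (m≤m+n K _) N′≤j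
        ... | K≤j with F.recur K≤j | H.recur K≤j
        ... | i , J≤i , i<j , eq , _ , hi | i* , J≤i* , _ , eq* , lo* , _ =
          suc i , j≡ , h<f′ , subst (suc i + suc i ≤_) (sym j≡) (+-monoˡ-≤ (suc i) (<⇒≤ (F.j<f K≤i)))
          where
          open ≤-Reasoning
          N₁≤i : N₁ ≤ i
          N₁≤i = F.late N₁ (≤-trans J≤N (m≤m+n N K)) J≤i (≤-trans (m≤n+m _ K) N′≤j) hi
          K≤i : K ≤ suc i
          K≤i = m≤n⇒m≤1+n (≤-trans (m≤n+m K N) N₁≤i)
          i<i* : suc i ≤ i*
          i<i* = ≤-pred (+-cancelˡ-≤ (h j) _ _ (begin
            h j + suc (suc i)   ≡⟨ +-suc (h j) (suc i) ⟩
            suc (h j) + suc i   ≤⟨ +-monoˡ-≤ (suc i) h<f ⟩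
            f j + suc i         ≡⟨ trans eq (sym eq*) ⟩
            h j + suc i*        ∎))
          H< : h (suc i) + suc i < j
          H< = ≤-<-trans (+-mono-≤ (H.mono≤ (m≤n⇒m≤1+n J≤i) i<i*) i<i*) lo*
          h<f′ : h (suc i) < f (suc i)
          h<f′ = +-cancelʳ-< (suc i) _ _ (<-≤-trans H< hi)
          j≡ : j ≡ f (suc i) + suc i
          j≡ = ≤-antisym hi (begin
            f (suc i) + suc i         ≤⟨ +-monoˡ-≤ (suc i) (close (m≤n⇒m≤1+n (≤-trans (m≤m+n N K) N₁≤i))) ⟩
            h (suc i) + 1 + suc i     ≡⟨ cong (_+ suc i) (+-comm (h (suc i)) 1) ⟩
            suc (h (suc i) + suc i)   ≤⟨ H< ⟩
            j                         ∎)

    abstract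
      -- A deviation below `2 ^ suc k` is below a constant or is the image under `f i + i` of a
      -- deviation below `2 ^ k`, so each doubling of the range adds at most that constant.
      sparse : ∃ λ C → ∀ k → ∃ λ L → length L ≡ suc (k * C) × (∀ {j} → j < 2 ^ k → h j < f j → j ∈ L)
      sparse with ancestor
      ... | N , anc = N , cover
        where
        cover : ∀ k → ∃ λ L → length L ≡ suc (k * N) × (∀ {j} → j < 2 ^ k → h j < f j → j ∈ L)
        cover zero    = upTo 1 , refl , λ j<1 _ → ∈-upTo⁺ j<1
        cover (suc k) with cover k
        ... | L , len , mem = upTo N ++ map (λ i → f i + i) L , len′ , mem′
          where
          len′ : length (upTo N ++ map (λ i → f i + i) L) ≡ suc (N + k * N)
          len′ = trans (length-++ (upTo N))
            (trans (cong₂ _+_ (length-upTo N) (trans (length-map _ L) len)) (+-suc N (k * N)))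
          mem′ : ∀ {j} → j < 2 ^ suc k → h j < f j → j ∈ upTo N ++ map (λ i → f i + i) L
          mem′ {j} j< h<f with N ≤? j
          ... | no  N≰j = ∈-++⁺ˡ (∈-upTo⁺ (≰⇒> N≰j))
          ... | yes N≤j with anc N≤j h<f
          ... | i , refl , h<f′ , i+i≤j = ∈-++⁺ʳ (upTo N) (∈-map⁺ (λ i → f i + i) (mem i< h<f′))
            where
            i< : i < 2 ^ k
            i< with i <? 2 ^ k
            ... | yes p = p
            ... | no ¬p = ⊥-elim (<⇒≱ j< (≤-trans (+-mono-≤ (≮⇒≥ ¬p) (subst (_≤ i) (sym (+-identityʳ (2 ^ k))) (≮⇒≥ ¬p))) i+i≤j))

  module _ {J K f} (F : Recursive J K f) where
    open Recursive F

    abstract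
      locate : ∀ {N x} → J ≤ N → K ≤ N → f N ≤ x → ∃ λ j → N ≤ j × f j ≤ x × x < f (suc j)
      locate {N} {x} J≤N K≤N fN≤x with crossing (λ n → f (n + N)) (suc x) (suc x) (s≤s fN≤x)
          (≤-trans (m≤m+n (suc x) N) (<⇒≤ (j<f (≤-trans K≤N (m≤n+m N (suc x))))))
      ... | n , _ , lo , hi = n + N , m≤n+m N n , ≤-pred lo , hi

  -- The height bound in `cell` serves the lower estimate of points in a disk. `except`, whose
  -- length is at most linear in `k` for columns below `2 ^ k`, serves the upper estimate of
  -- disagreements.
  record Agreement (Cell₁ Cell₂ : ℤ → ℤ → Set) : Set where
    field
      X C      : ℕ
      cell     : ∀ {x} → X ≤ x → ∃ λ y → y ≤ x + x × Cell₁ (+ x) (+ y)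
      except   : ℕ → List ℕ
      few      : ∀ k → length (except k) ≤ 4 + k * C
      agree    : ∀ {x} k → X ≤ x → x < 2 ^ k → (∃ λ y → Cell₁ (+ x) y × Cell₂ (+ x) y) ⊎ x ∈ except k

  module _ {Cell₁ Cell₂ : ℤ → ℤ → Set} {J K f h} (J≤K : J ≤ K) (F : Recursive J K f) (H : Recursive J K h)
    (upper₁ : ∀ {j} → J ≤ j → Cell₁ (+ f j) (+ (f j + j)))
    (lower₁ : ∀ {j x} → J ≤ j → f j < x → x < f (suc j) → Cell₁ (+ x) (+ j))
    (upper₂ : ∀ {j} → J ≤ j → Cell₂ (+ h j) (+ (h j + j)))
    (lower₂ : ∀ {j x} → J ≤ j → h j < x → x < h (suc j) → Cell₂ (+ x) (+ j)) where
    private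
      module F = Recursive F
      module H = Recursive H
      N₁ = proj₁ (is-near F H)
      N₂ = proj₁ (is-near H F)
      N = K + (N₁ ⊔ N₂)
      K≤N : K ≤ N
      K≤N = m≤m+n K _
      J≤N : J ≤ N
      J≤N = ≤-trans J≤K K≤N

      f≤h+1 : ∀ {j} → N ≤ j → f j ≤ h j + 1
      f≤h+1 N≤j = proj₂ (proj₂ (is-near F H)) (≤-trans (≤-trans (m≤m⊔n N₁ N₂) (m≤n+m _ K)) N≤j)
      h≤f+1 : ∀ {j} → N ≤ j → h j ≤ f j + 1
      h≤f+1 N≤j = proj₂ (proj₂ (is-near H F)) (≤-trans (≤-trans (m≤n⊔m N₁ N₂) (m≤n+m _ K)) N≤j)

      C₁ = proj₁ (sparse F H)
      C₂ = proj₁ (sparse H F)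

      -- A deviation at j affects only the two columns `f j` and `h j`.
      L₁ L₂ L : ℕ → List ℕ
      L₁ k = proj₁ (proj₂ (sparse F H) k)
      L₂ k = proj₁ (proj₂ (sparse H F) k)
      L k = map f (L₁ k ++ L₂ k) ++ map h (L₁ k ++ L₂ k)

      deviant : ∀ {k j} → j < 2 ^ k → f j ≢ h j → j ∈ L₁ k ++ L₂ k
      deviant {k} {j} j< f≢h with <-cmp (f j) (h j)
      ... | tri< lt _ _ = ∈-++⁺ʳ (L₁ k) (proj₂ (proj₂ (proj₂ (sparse H F) k)) j< lt)
      ... | tri≈ _ eq _ = ⊥-elim (f≢h eq)
      ... | tri> _ _ gt = ∈-++⁺ˡ (proj₂ (proj₂ (proj₂ (sparse F H) k)) j< gt)

      length-L : ∀ k → length (L k) ≡ 2 * (suc (k * C₁) + suc (k * C₂))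
      length-L k = trans (length-++ (map f (L₁ k ++ L₂ k)))
        (trans (cong₂ _+_ (trans (length-map f (L₁ k ++ L₂ k)) len) (trans (length-map h (L₁ k ++ L₂ k)) len)) (double (suc (k * C₁) + suc (k * C₂))))
        where
        double : ∀ a → a + a ≡ 2 * a
        double = solve-∀
        len : length (L₁ k ++ L₂ k) ≡ suc (k * C₁) + suc (k * C₂)
        len = trans (length-++ (L₁ k))
                (cong₂ _+_ (proj₁ (proj₂ (proj₂ (sparse F H) k))) (proj₁ (proj₂ (proj₂ (sparse H F) k))))

      -- Since `f` and `h` differ by at most 1, a column strictly inside a gap of each lies in gaps
      -- of equal index. So lower cells agree even where an endpoint of the gap deviates.
      same : ∀ {j l x} → N ≤ j → N ≤ l → x < f (suc j) → h l < x → x < h (suc l) → f j < x → j ≡ l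
      same {j} {l} {x} N≤j N≤l x<f h<x x<h f<x with <-cmp j l
      ... | tri≈ _ eq _ = eq
      ... | tri< j<l _ _ = ⊥-elim (n≮n _ (begin-strict
        f (suc j)       ≤⟨ f≤h+1 (m≤n⇒m≤1+n N≤j) ⟩
        h (suc j) + 1   ≤⟨ +-monoˡ-≤ 1 (H.mono≤ (≤-trans J≤N (m≤n⇒m≤1+n N≤j)) j<l) ⟩
        h l + 1         ≡⟨ +-comm (h l) 1 ⟩
        suc (h l)       ≤⟨ h<x ⟩
        x               <⟨ x<f ⟩
        f (suc j)       ∎))
        where open ≤-Reasoning
      ... | tri> _ _ l<j = ⊥-elim (n≮n _ (begin-strict
        h (suc l)       ≤⟨ h≤f+1 (m≤n⇒m≤1+n N≤l) ⟩
        f (suc l) + 1   ≤⟨ +-monoˡ-≤ 1 (F.mono≤ (≤-trans J≤N (m≤n⇒m≤1+n N≤l)) l<j) ⟩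
        f j + 1         ≡⟨ +-comm (f j) 1 ⟩
        suc (f j)       ≤⟨ f<x ⟩
        x               <⟨ x<h ⟩
        h (suc l)       ∎))
        where open ≤-Reasoning

    agreement-of : Agreement Cell₁ Cell₂
    agreement-of = record
      { X = f N + h N ; C = 2 * (C₁ + C₂)
      ; cell = cell′ ; except = L ; few = λ k → ≤-reflexive (trans (length-L k) (collect k C₁ C₂)) ; agree = agree′ }
      where
      collect : ∀ k a b → 2 * (suc (k * a) + suc (k * b)) ≡ 4 + k * (2 * (a + b))
      collect = solve-∀
      cell′ : ∀ {x} → f N + h N ≤ x → ∃ λ y → y ≤ x + x × Cell₁ (+ x) (+ y)
      cell′ {x} X≤x with locate F J≤N K≤N (≤-trans (m≤m+n (f N) _) X≤x)
      ... | j , N≤j , f≤x , x<f with m≤n⇒m<n∨m≡n f≤x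
      ... | inj₁ f<x  = j , ≤-trans (<⇒≤ (F.j<f (≤-trans K≤N N≤j))) (≤-trans f≤x (m≤m+n x x))
                      , lower₁ (≤-trans J≤N N≤j) f<x x<f
      ... | inj₂ refl = f j + j , +-monoʳ-≤ (f j) (<⇒≤ (F.j<f (≤-trans K≤N N≤j))) , upper₁ (≤-trans J≤N N≤j)
      agree′ : ∀ {x} k → f N + h N ≤ x → x < 2 ^ k → (∃ λ y → Cell₁ (+ x) y × Cell₂ (+ x) y) ⊎ x ∈ L k
      agree′ {x} k X≤x x< with locate F J≤N K≤N (≤-trans (m≤m+n (f N) _) X≤x)
                             | locate H J≤N K≤N (≤-trans (m≤n+m (h N) (f N)) X≤x)
      ... | j , N≤j , f≤x , x<f | l , N≤l , h≤x , x<h with m≤n⇒m<n∨m≡n f≤x | m≤n⇒m<n∨m≡n h≤x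
      ... | inj₁ f<x  | inj₁ h<x  = inj₁ (+ j , lower₁ (≤-trans J≤N N≤j) f<x x<f
                                  , subst (Cell₂ (+ x) ∘ +_) (sym (same N≤j N≤l x<f h<x x<h f<x)) (lower₂ (≤-trans J≤N N≤l) h<x x<h))
      ... | inj₂ refl | _ with f j ≟ h j
      ... | yes eq = inj₁ (+ (f j + j) , upper₁ (≤-trans J≤N N≤j)
                   , subst (λ x → Cell₂ (+ x) (+ (x + j))) (sym eq) (upper₂ (≤-trans J≤N N≤j)))
      ... | no f≢h = inj₂ (∈-++⁺ˡ (∈-map⁺ f (deviant {k} (<-trans (F.j<f (≤-trans K≤N N≤j)) x<) f≢h)))
      agree′ {x} k X≤x x< | j , N≤j , f≤x , x<f | l , N≤l , h≤x , x<h | inj₁ _ | inj₂ refl with f l ≟ h l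
      ... | yes eq = inj₁ (+ (h l + l) , subst (λ x → Cell₁ (+ x) (+ (x + l))) eq (upper₁ (≤-trans J≤N N≤l))
                   , upper₂ (≤-trans J≤N N≤l))
      ... | no f≢h = inj₂ (∈-++⁺ʳ (map f (L₁ k ++ L₂ k)) (∈-map⁺ h (deviant {k} (<-trans (H.j<f (≤-trans K≤N N≤l)) x<) f≢h)))

  agreement : ∀ {Cell₁ Cell₂} → Profile Cell₁ → Profile Cell₂ → Agreement Cell₁ Cell₂
  agreement P Q
    with restrict (P.J ⊔ Q.J) (m≤m⊔n P.J Q.J) record { mono = P.mono ; recur = P.recur }
       | restrict (P.J ⊔ Q.J) (m≤n⊔m P.J Q.J) record { mono = Q.mono ; recur = Q.recur }
    where
    module P = Profile P
    module Q = Profile Q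
  ... | K₁ , F | K₂ , H = agreement-of (m≤m+n (P.J ⊔ Q.J) (K₁ ⊔ K₂))
      (F (≤-trans (m≤m⊔n K₁ K₂) (m≤n+m _ (P.J ⊔ Q.J)))) (H (≤-trans (m≤n⊔m K₁ K₂) (m≤n+m _ (P.J ⊔ Q.J))))
      (P.upper ∘ ≤-trans (m≤m⊔n P.J Q.J)) (P.lower ∘ ≤-trans (m≤m⊔n P.J Q.J))
      (Q.upper ∘ ≤-trans (m≤n⊔m P.J Q.J)) (Q.lower ∘ ≤-trans (m≤n⊔m P.J Q.J))
    where
    module P = Profile P
    module Q = Profile Q

-- Counting lattice points in a disk.

module Disk where
  open import Data.Bool using (Bool; true; false; T; _∧_)
  open import Data.Bool.Properties using (T-≡)
  open import Data.Empty using (⊥-elim)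
  open import Data.Integer as ℤ using (ℤ; +_; -[1+_]; ∣_∣)
  import Data.Integer.Properties as ℤ
  open import Data.Integer.Tactic.RingSolver using (solve-∀)
  open import Data.List using ([]; _++_; length)
  open import Data.List.Membership.Propositional using (_∈_)
  open import Data.List.Membership.Propositional.Properties using (∈-++⁺ˡ; ∈-++⁺ʳ)
  open import Data.List.Properties using (length-++)
  import Data.List.Relation.Unary.AllPairs as AllPairs
  open import Data.List.Relation.Unary.Unique.Propositional using (Unique)
  open import Data.Nat
  open import Data.Nat.Properties
  open import Data.Product using (∃; _×_; _,_)
  open import Data.Sum using (_⊎_; inj₁; inj₂)
  open import Function.Bundles using (Equivalence)
  open import Relation.Binary.PropositionalEquality
  open import Relation.Nullary using (yes; no)
  open Counting

  Disk : ℕ → ℤ → ℤ → Set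
  Disk n a b = ∣ a ∣ * ∣ a ∣ + ∣ b ∣ * ∣ b ∣ ≤ n * n

  disk? : ℕ → ℤ → ℤ → Bool
  disk? n a b = ∣ a ℤ.* a ℤ.+ b ℤ.* b ∣ ≤ᵇ n * n

  -- countDisk's local functions row and go, recovered by unification.
  mutual
    row : SetZ² → ℕ → ℤ → ℕ → ℕ
    row = _

    go : SetZ² → ℕ → ℕ → ℕ
    go = _

    countDisk≡go : ∀ S n → countDisk S n ≡ go S n (2 * n + 1)
    -- Generalising the bound to a variable leaves the unknown `go` applied to distinct variables,
    -- which determines it.
    countDisk≡go S n with 2 * n + 1
    ... | w = refl

    go-suc : ∀ S n i → go S n (suc i) ≡ row S n (+ i ℤ.- + n) (2 * n + 1) + go S n i
    go-suc S n i with + i ℤ.- + n | 2 * n + 1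
    ... | a | w = refl

  ∣i*i∣ : ∀ i → i ℤ.* i ≡ + (∣ i ∣ * ∣ i ∣)
  ∣i*i∣ (+ m)      = ℤ.+◃n≡+n (m * m)
  ∣i*i∣ -[1+ m ] = refl

  disk⇒ : ∀ n a b → disk? n a b ≡ true → Disk n a b
  disk⇒ n a b eq = subst (λ k → ∣ k ∣ ≤ n * n) (cong₂ ℤ._+_ (∣i*i∣ a) (∣i*i∣ b))
    (≤ᵇ⇒≤ _ _ (Equivalence.from T-≡ eq))

  disk⇐ : ∀ n a b → Disk n a b → disk? n a b ≡ true
  disk⇐ n a b le = Equivalence.to T-≡ (≤⇒≤ᵇ
    (subst (λ k → ∣ k ∣ ≤ n * n) (sym (cong₂ ℤ._+_ (∣i*i∣ a) (∣i*i∣ b))) le))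

  offset-injective : ∀ n {i j} → + i ℤ.- + n ≡ + j ℤ.- + n → i ≡ j
  offset-injective n {i} {j} eq = ℤ.+-injective
    (trans (sym (cancel (+ i) (+ n))) (trans (cong (ℤ._+ + n) eq) (cancel (+ j) (+ n))))
    where
    cancel : ∀ i n → i ℤ.- n ℤ.+ n ≡ i
    cancel = solve-∀

  offset : ∀ n a → ∣ a ∣ ≤ n → ∃ λ i → i < 2 * n + 1 × a ≡ + i ℤ.- + n
  offset n (+ m) m≤n = m + n , bound , sym (m+n-n (+ m) (+ n))
    where
    m+n-n : ∀ m n → m ℤ.+ n ℤ.- n ≡ m
    m+n-n = solve-∀
    bound : m + n < 2 * n + 1
    bound rewrite +-comm (2 * n) 1 | +-identityʳ n = s≤s (+-monoˡ-≤ n m≤n)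
  offset n -[1+ m ] m<n = n ∸ suc m , bound , sym eq
    where
    bound : n ∸ suc m < 2 * n + 1
    bound rewrite +-comm (2 * n) 1 = s≤s (≤-trans (m∸n≤m n (suc m)) (m≤m+n n _))
    cancel : ∀ n m → n ℤ.- m ℤ.- n ≡ ℤ.- m
    cancel = solve-∀
    eq : + (n ∸ suc m) ℤ.- + n ≡ -[1+ m ]
    eq = trans (cong (ℤ._- + n) (trans (sym (ℤ.⊖-≥ m<n)) (sym (ℤ.m-n≡m⊖n n (suc m))))) (cancel (+ n) (+ suc m))

  square-≤ : ∀ {m n} k → m * m + k ≤ n * n → m ≤ n
  square-≤ {m} {n} k le with m ≤? n
  ... | yes m≤n = m≤n
  ... | no  m≰n = ⊥-elim (<⇒≱ (*-mono-< (≰⇒> m≰n) (≰⇒> m≰n)) (≤-trans (m≤m+n (m * m) k) le))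

  module _ (S : SetZ²) (n : ℕ) where

    On : ℤ × ℤ → Set
    On (a , b) = disk? n a b ∧ S a b ≡ true

    InRow : ℤ → ℕ → ℤ × ℤ → Set
    InRow a j (a' , b) = On (a' , b) × a' ≡ a × ∃ λ i → i < j × b ≡ + i ℤ.- + n

    InRows : ℕ → ℤ × ℤ → Set
    InRows k (a , b) = On (a , b) × (∃ λ i → i < k × a ≡ + i ℤ.- + n) × ∃ λ i → i < 2 * n + 1 × b ≡ + i ℤ.- + n

    row-count : ∀ a j → Count (InRow a j) (+ row S n a j)
    row-count a zero = count [] AllPairs.[] (λ ()) (λ { (_ , _ , _ , () , _) }) refl
    row-count a (suc j) with disk? n a (+ j ℤ.- + n) ∧ S a (+ j ℤ.- + n) in eq
    ... | true = Count-add (a , + j ℤ.- + n) (row-count a j)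
        (λ { (_ , _ , i , i<j , eq) → <⇒≢ i<j (sym (offset-injective n eq)) })
        (eq , refl , j , ≤-refl , refl)
        (λ (on , a≡ , i , i<j , b≡) → on , a≡ , i , m≤n⇒m≤1+n i<j , b≡)
        split
      where
      split : ∀ {p} → InRow a (suc j) p → InRow a j p ⊎ p ≡ (a , + j ℤ.- + n)
      split (on , refl , i , s≤s i≤j , refl) with m≤n⇒m<n∨m≡n i≤j
      ... | inj₁ i<j  = inj₁ (on , refl , i , i<j , refl)
      ... | inj₂ refl = inj₂ refl
    ... | false = count elements unique (λ k∈ → grow (sound k∈)) (λ r → complete (shrink r)) size
      where
      open Count (row-count a j)
      grow : ∀ {p} → InRow a j p → InRow a (suc j) p
      grow (on , a≡ , i , i<j , b≡) = on , a≡ , i , m≤n⇒m≤1+n i<j , b≡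
      shrink : ∀ {p} → InRow a (suc j) p → InRow a j p
      shrink (on , refl , i , s≤s i≤j , refl) with m≤n⇒m<n∨m≡n i≤j
      ... | inj₁ i<j  = on , refl , i , i<j , refl
      ... | inj₂ refl with trans (sym on) eq
      ... | ()

    rows-count : ∀ k → Count (InRows k) (+ go S n k)
    rows-count zero = count [] AllPairs.[] (λ ()) (λ { (_ , (_ , () , _) , _) }) refl
    rows-count (suc k) rewrite go-suc S n k = Count-⊎ (row-count (+ k ℤ.- + n) (2 * n + 1)) (rows-count k)
        (λ { (_ , a≡ , _) (_ , (i , i<k , a≡′) , _) → <⇒≢ i<k (offset-injective n (trans (sym a≡′) a≡)) })
        join split
      where
      join : ∀ {p} → InRow (+ k ℤ.- + n) (2 * n + 1) p ⊎ InRows k p → InRows (suc k) p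
      join (inj₁ (on , a≡ , b)) = on , (k , ≤-refl , a≡) , b
      join (inj₂ (on , (i , i<k , a≡) , b)) = on , (i , m≤n⇒m≤1+n i<k , a≡) , b
      split : ∀ {p} → InRows (suc k) p → InRow (+ k ℤ.- + n) (2 * n + 1) p ⊎ InRows k p
      split (on , (i , s≤s i≤k , refl) , b) with m≤n⇒m<n∨m≡n i≤k
      ... | inj₁ i<k  = inj₂ (on , (i , i<k , refl) , b)
      ... | inj₂ refl = inj₁ (on , refl , b)

    disk-count : Count (λ (a , b) → S a b ≡ true × Disk n a b) (+ countDisk S n)
    disk-count = count elements unique (λ k∈ → sound′ (sound k∈)) (λ q → complete (complete′ q))
        (trans size (cong +_ (sym (countDisk≡go S n))))
      where
      open Count (rows-count (2 * n + 1))
      sound′ : ∀ {a b} → InRows (2 * n + 1) (a , b) → S a b ≡ true × Disk n a b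
      sound′ {a} {b} (on , _) with disk? n a b in eq
      ... | true = on , disk⇒ n a b eq
      complete′ : ∀ {a b} → S a b ≡ true × Disk n a b → InRows (2 * n + 1) (a , b)
      complete′ {a} {b} (s , disk) rewrite disk⇐ n a b disk = s
        , offset n a (square-≤ _ disk)
        , offset n b (square-≤ (∣ a ∣ * ∣ a ∣) (subst (_≤ n * n) (+-comm (∣ a ∣ * ∣ a ∣) _) disk))

  length≤countDisk : ∀ {S n L} → Unique L → (∀ {a b} → (a , b) ∈ L → S a b ≡ true × Disk n a b) → length L ≤ countDisk S n
  length≤countDisk {S} {n} u f = subst (_ ≤_) (ℤ.+-injective size) (unique-⊆⇒length≤ u λ p∈ → complete (f p∈))
    where open Count (disk-count S n)

  countDisk-∪≤ : ∀ {S T n} L → (∀ {a b} → (S ∪ T) a b ≡ true → Disk n a b → (S ∩ T) a b ≡ true ⊎ (a , b) ∈ L) →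
    countDisk (S ∪ T) n ≤ countDisk (S ∩ T) n + length L
  countDisk-∪≤ {S} {T} {n} L cover = subst₂ _≤_ (ℤ.+-injective U.size)
      (trans (length-++ I.elements) (cong (_+ length L) (ℤ.+-injective I.size)))
      (unique-⊆⇒length≤ U.unique λ p∈ → into (U.sound p∈))
    where
    module U = Count (disk-count (S ∪ T) n)
    module I = Count (disk-count (S ∩ T) n)
    into : ∀ {a b} → (S ∪ T) a b ≡ true × Disk n a b → (a , b) ∈ I.elements ++ L
    into (s , disk) with cover s disk
    ... | inj₁ i  = ∈-++⁺ˡ (I.complete (i , disk))
    ... | inj₂ p∈ = ∈-++⁺ʳ I.elements p∈

-- Logarithmically many exceptions against linearly many positions.

module Asymptotics where
  open import Data.Bool using (true; false)
  open import Data.Empty using (⊥-elim)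
  open import Data.Integer as ℤ using (ℤ; +_)
  import Data.Integer.Properties as ℤ
  open import Data.List using (List; _++_; length; map; upTo)
  open import Data.List.Membership.Propositional using (_∈_)
  open import Data.List.Membership.Propositional.Properties using (∈-++⁺ˡ; ∈-++⁺ʳ; ∈-map⁺; ∈-map⁻; ∈-upTo⁻)
  open import Data.List.Properties using (length-++; length-map; length-upTo)
  open import Data.List.Relation.Unary.Unique.Propositional.Properties using (map⁺; upTo⁺)
  open import Data.Nat
  open import Data.Nat.Properties
  open import Data.Nat.Tactic.RingSolver using (solve-∀)
  open import Data.Product using (∃; _×_; _,_; proj₁; proj₂)
  open import Data.Sum using (_⊎_; inj₁; inj₂)
  open import Relation.Binary.PropositionalEquality
  open import Relation.Nullary using (yes; no)
  open Phases using (crossing)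
  open Compare
  open Disk

  n<2^n : ∀ n → n < 2 ^ n
  n<2^n zero    = s≤s z≤n
  n<2^n (suc n) = begin-strict
    suc n               <⟨ s≤s (n<2^n n) ⟩
    1 + 2 ^ n           ≤⟨ +-monoˡ-≤ (2 ^ n) (≤-trans (s≤s z≤n) (n<2^n n)) ⟩
    2 ^ n + 2 ^ n       ≡⟨ cong (_+_ (2 ^ n)) (+-identityʳ (2 ^ n)) ⟨
    2 ^ suc n           ∎
    where open ≤-Reasoning

  binary-size : ∀ b {n} → 2 ^ b ≤ n → ∃ λ i → 2 ^ (i + b) ≤ n × n < 2 ^ suc (i + b)
  binary-size b {n} lo with crossing (λ i → 2 ^ (i + b)) (suc n) n (s≤s lo)
      (≤-trans (n<2^n n) (^-monoʳ-≤ 2 (m≤m+n n b)))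
  ... | i , _ , l , h = i , ≤-pred l , h

  -- The offset `3 * A` makes the base case work: `A * (3 * A + 1)` is at most the cube of `A + 1`,
  -- and `A + 1 ≤ 2 ^ A`. Each step then adds `A` on the left and doubles the right.
  linear≤2^ : ∀ A i → A * (i + 3 * A + 1) ≤ 2 ^ (i + 3 * A)
  linear≤2^ A zero = begin
    A * (3 * A + 1)                  ≤⟨ m≤m+n _ (A * A * A + 2 * A + 1) ⟩
    A * (3 * A + 1) + (A * A * A + 2 * A + 1)  ≡⟨ cube A ⟩
    suc A * (suc A * suc A)          ≤⟨ *-mono-≤ (n<2^n A) (*-mono-≤ (n<2^n A) (n<2^n A)) ⟩
    2 ^ A * (2 ^ A * 2 ^ A)          ≡⟨ cong (2 ^ A *_) (^-distribˡ-+-* 2 A A) ⟨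
    2 ^ A * 2 ^ (A + A)              ≡⟨ ^-distribˡ-+-* 2 A (A + A) ⟨
    2 ^ (A + (A + A))                ≡⟨ cong (2 ^_) (triple A) ⟩
    2 ^ (3 * A)                      ∎
    where
    open ≤-Reasoning
    cube : ∀ A → A * (3 * A + 1) + (A * A * A + 2 * A + 1) ≡ suc A * (suc A * suc A)
    cube = solve-∀
    triple : ∀ A → A + (A + A) ≡ 3 * A
    triple = solve-∀
  linear≤2^ A (suc i) = begin
    A * (suc (i + 3 * A) + 1)          ≡⟨ *-suc A (i + 3 * A + 1) ⟩
    A + A * (i + 3 * A + 1)            ≤⟨ +-mono-≤ A≤ (linear≤2^ A i) ⟩
    2 ^ (i + 3 * A) + 2 ^ (i + 3 * A)  ≡⟨ cong (_+_ (2 ^ (i + 3 * A))) (+-identityʳ _) ⟨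
    2 ^ suc (i + 3 * A)                ∎
    where
    open ≤-Reasoning
    A≤ : A ≤ 2 ^ (i + 3 * A)
    A≤ = ≤-trans (≤-trans (m≤m+n A (A + (A + 0))) (m≤n+m (3 * A) i)) (<⇒≤ (n<2^n (i + 3 * A)))

  -- Far to the right the set has at most one point per column; `old` says that what remains is
  -- finite, including any points that the shift moved to negative coordinates.
  record Columnar (S : SetZ²) (Cell : ℤ → ℤ → Set) : Set where
    field
      to     : ∀ {a b} → Cell a b → S a b ≡ true
      D      : ℕ
      col    : ℕ → ℤ
      unique : ∀ {x b} → D ≤ x → S (+ x) b ≡ true → b ≡ col x
      old    : ∀ X → ∃ λ L → ∀ {a b} → S a b ≡ true → (a , b) ∈ L ⊎ ∃ λ x → X ≤ x × a ≡ + x × b ≡ col x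

  module _ {S T Cell₁ Cell₂} (P : Columnar S Cell₁) (Q : Columnar T Cell₂) (A : Agreement Cell₁ Cell₂) where
    private
      module P = Columnar P
      module Q = Columnar Q
      module A = Agreement A

      X : ℕ
      X = A.X + (P.D + Q.D)
      X≥A : A.X ≤ X
      X≥A = m≤m+n A.X _
      X≥P : P.D ≤ X
      X≥P = ≤-trans (m≤m+n P.D Q.D) (m≤n+m _ A.X)
      X≥Q : Q.D ≤ X
      X≥Q = ≤-trans (m≤n+m Q.D P.D) (m≤n+m _ A.X)

      pt₁ pt₂ : ℕ → ℤ × ℤ
      pt₁ x = + x , P.col x
      pt₂ x = + x , Q.col x

      Old : List (ℤ × ℤ)
      Old = proj₁ (P.old X) ++ proj₁ (Q.old X)

      L : ℕ → List (ℤ × ℤ)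
      L k = Old ++ map pt₁ (A.except k) ++ map pt₂ (A.except k)

      length-L : ∀ k → length (L k) ≤ length Old + ((4 + k * A.C) + (4 + k * A.C))
      length-L k = begin
        length (L k)                                            ≡⟨ length-++ Old ⟩
        length Old + length (map pt₁ (A.except k) ++ map pt₂ (A.except k))
          ≡⟨ cong (λ e → length Old + e) (trans (length-++ (map pt₁ (A.except k))) (cong₂ _+_ (length-map pt₁ (A.except k)) (length-map pt₂ (A.except k)))) ⟩
        length Old + (length (A.except k) + length (A.except k)) ≤⟨ +-monoʳ-≤ (length Old) (+-mono-≤ (A.few k) (A.few k)) ⟩
        length Old + ((4 + k * A.C) + (4 + k * A.C))            ∎
        where open ≤-Reasoning

      both : ∀ {a b} → S a b ≡ true → T a b ≡ true → (S ∩ T) a b ≡ true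
      both s t rewrite s | t = refl

      either : ∀ {a b} → (S ∪ T) a b ≡ true → S a b ≡ true ⊎ T a b ≡ true
      either {a} {b} u with S a b in s
      ... | true  = inj₁ refl
      ... | false = inj₂ u

      cover : ∀ {n a b} k → n < 2 ^ k → (S ∪ T) a b ≡ true → Disk n a b → (S ∩ T) a b ≡ true ⊎ (a , b) ∈ L k
      cover {n} {a} {b} k n< u disk with either {a} {b} u
      ... | inj₁ s with proj₂ (P.old X) s
      ... | inj₁ m = inj₂ (∈-++⁺ˡ (∈-++⁺ˡ m))
      ... | inj₂ (x , X≤x , refl , refl) with A.agree k (≤-trans X≥A X≤x) (≤-<-trans (square-≤ _ disk) n<)
      ... | inj₂ x∈ = inj₂ (∈-++⁺ʳ Old (∈-++⁺ˡ (∈-map⁺ pt₁ x∈)))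
      ... | inj₁ (y , c₁ , c₂) rewrite P.unique (≤-trans X≥P X≤x) (P.to c₁) = inj₁ (both s (Q.to c₂))
      cover {n} {a} {b} k n< u disk | inj₂ t with proj₂ (Q.old X) t
      ... | inj₁ m = inj₂ (∈-++⁺ˡ (∈-++⁺ʳ (proj₁ (P.old X)) m))
      ... | inj₂ (x , X≤x , refl , refl) with A.agree k (≤-trans X≥A X≤x) (≤-<-trans (square-≤ _ disk) n<)
      ... | inj₂ x∈ = inj₂ (∈-++⁺ʳ Old (∈-++⁺ʳ (map pt₁ (A.except k)) (∈-map⁺ pt₂ x∈)))
      ... | inj₁ (y , c₁ , c₂) rewrite Q.unique (≤-trans X≥Q X≤x) (Q.to c₂) = inj₁ (both (P.to c₁) t)

      -- A point with `y ≤ x + x` has squared norm at most 5x², which is below (4x)². The factor 4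
      -- is a power of two, to suit the dyadic scale of the exceptions.
      many : ∀ {n} K → (∀ {i} → i < K → 4 * (i + X) ≤ n) → K ≤ countDisk (S ∪ T) n
      many {n} K small = ≤-trans (≤-reflexive (sym (trans (length-map pt (upTo K)) (length-upTo K))))
        (length≤countDisk {S ∪ T} {n} (map⁺ pt-injective (upTo⁺ K)) inside)
        where
        pt : ℕ → ℤ × ℤ
        pt i = pt₁ (i + X)
        pt-injective : ∀ {i j} → pt i ≡ pt j → i ≡ j
        pt-injective {i} {j} eq = +-cancelʳ-≡ X i j (ℤ.+-injective (cong proj₁ eq))
        expand : ∀ x → x * x + (x + x) * (x + x) + 11 * (x * x) ≡ (4 * x) * (4 * x)
        expand = solve-∀
        inside : ∀ {a b} → (a , b) ∈ map pt (upTo K) → (S ∪ T) a b ≡ true × Disk n a b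
        inside p∈ with ∈-map⁻ pt p∈
        ... | i , i∈ , refl with A.cell (≤-trans X≥A (m≤n+m X i))
        ... | y , y≤ , c rewrite sym (P.unique (≤-trans X≥P (m≤n+m X i)) (P.to c)) | P.to c = refl , (begin
          x * x + y * y                               ≤⟨ +-monoʳ-≤ (x * x) (*-mono-≤ y≤ y≤) ⟩
          x * x + (x + x) * (x + x)                   ≤⟨ m≤m+n _ (11 * (x * x)) ⟩
          x * x + (x + x) * (x + x) + 11 * (x * x)    ≡⟨ expand x ⟩
          (4 * x) * (4 * x)                           ≤⟨ *-mono-≤ (small (∈-upTo⁻ i∈)) (small (∈-upTo⁻ i∈)) ⟩
          n * n                                       ∎)
          where
          open ≤-Reasoning
          x = i + X

    asymptotic : AsymptoticallyEqual S T
    -- `3 * M` is the offset of `linear≤2^`, and the 2 in the exponent pays for the factor 4 of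
    -- `many`.
    asymptotic m = 2 ^ (3 * M + 2) , λ n N≤n → bound n (binary-size (3 * M + 2) N≤n)
      where
      -- For radii between `2 ^ (l + 2)` and `2 ^ (l + 3)` there are at most
      -- `length Old + 8 + 2 * (l + 3) * A.C` exceptions. `M` collects the terms free of l and is
      -- large enough that `M * (l + 1)` bounds `suc m` times that number plus `X + 1`.
      M = suc m * (length Old + 8 + 6 * A.C) + X + 1
      bound : ∀ n → (∃ λ i → 2 ^ (i + (3 * M + 2)) ≤ n × n < 2 ^ suc (i + (3 * M + 2))) →
        (0 < countDisk (S ∪ T) n) × (m * countDisk (S ∪ T) n ≤ suc m * countDisk (S ∩ T) n)
      bound n (i , lo , hi) = ≤-trans K>0 (many K small) , ratio
        where
        open ≤-Reasoning
        l k K e : ℕ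
        l = i + 3 * M
        k = suc (i + (3 * M + 2))
        K = 2 ^ l ∸ X
        e = length (L k)
        k≡ : k ≡ l + 3
        k≡ = lemma i (3 * M)
          where
          lemma : ∀ i a → suc (i + (a + 2)) ≡ i + a + 3
          lemma = solve-∀
        collect : ∀ m o c x l → suc m * (o + ((4 + (l + 3) * c) + (4 + (l + 3) * c))) + x + 1 + l * (suc m * (o + 8 + 4 * c) + x + 1)
          ≡ (suc m * (o + 8 + 6 * c) + x + 1) * (l + 1)
        collect = solve-∀
        enough : suc m * e + X + 1 ≤ 2 ^ l
        enough = begin
          suc m * e + X + 1
            ≤⟨ +-monoˡ-≤ 1 (+-monoˡ-≤ X (*-monoʳ-≤ (suc m) (subst (λ k → e ≤ length Old + ((4 + k * A.C) + (4 + k * A.C))) k≡ (length-L k)))) ⟩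
          suc m * (length Old + ((4 + (l + 3) * A.C) + (4 + (l + 3) * A.C))) + X + 1
            ≤⟨ m≤m+n _ (l * (suc m * (length Old + 8 + 4 * A.C) + X + 1)) ⟩
          suc m * (length Old + ((4 + (l + 3) * A.C) + (4 + (l + 3) * A.C))) + X + 1 + l * (suc m * (length Old + 8 + 4 * A.C) + X + 1)
            ≡⟨ collect m (length Old) A.C X l ⟩
          M * (l + 1)
            ≤⟨ linear≤2^ M i ⟩
          2 ^ l ∎
        room : suc (suc m * e) ≤ K
        room = m+n≤o⇒m≤o∸n (suc (suc m * e)) (subst (_≤ 2 ^ l) (shuffle (suc m * e) X) enough)
          where
          shuffle : ∀ a x → a + x + 1 ≡ suc a + x
          shuffle = solve-∀
        K>0 : 0 < K
        K>0 = ≤-trans (s≤s z≤n) room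
        small : ∀ {j} → j < K → 4 * (j + X) ≤ n
        small {j} j<K = begin
          4 * (j + X)            ≤⟨ *-monoʳ-≤ 4 (m<n∸o⇒m+o≤n j<K) ⟩
          4 * 2 ^ l              ≡⟨ *-comm 4 (2 ^ l) ⟩
          2 ^ l * 2 ^ 2          ≡⟨ ^-distribˡ-+-* 2 l 2 ⟨
          2 ^ (l + 2)            ≡⟨ cong (2 ^_) (+-assoc i (3 * M) 2) ⟩
          2 ^ (i + (3 * M + 2))  ≤⟨ lo ⟩
          n                      ∎
          where
          m<n∸o⇒m+o≤n : ∀ {m n o} → m < n ∸ o → m + o ≤ n
          m<n∸o⇒m+o≤n {m} {n} {o} lt with o ≤? n
          ... | yes o≤n = ≤-trans (+-monoˡ-≤ o (<⇒≤ lt)) (≤-reflexive (m∸n+n≡m o≤n))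
          ... | no  o≰n = ⊥-elim (<⇒≱ lt (subst (_≤ m) (sym (m≤n⇒m∸n≡0 (<⇒≤ (≰⇒> o≰n)))) z≤n))
        u = countDisk (S ∪ T) n
        v = countDisk (S ∩ T) n
        ratio : m * u ≤ suc m * v
        ratio = +-cancelʳ-≤ (suc m * e) (m * u) (suc m * v) (begin
          m * u + suc m * e    ≤⟨ +-monoʳ-≤ (m * u) (≤-trans (n≤1+n _) (≤-trans room (many K small))) ⟩
          m * u + u            ≡⟨ +-comm (m * u) u ⟩
          suc m * u            ≤⟨ *-monoʳ-≤ (suc m) (countDisk-∪≤ {S} {T} {n} (L k) (λ {a} {b} → cover {n} {a} {b} k hi)) ⟩
          suc m * (v + e)      ≡⟨ *-distribˡ-+ (suc m) v e ⟩
          suc m * v + suc m * e ∎)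

-- P-positions in columns without prescribed labels.

module Label where
  open import Data.Bool using (Bool; true; false; not; _∨_)
  open import Data.Bool.Properties using (T-≡; ∨-zeroʳ)
  open import Data.Empty using (⊥-elim)
  open import Data.List using (List; []; _∷_; _++_)
  open import Data.Nat
  open import Data.Nat.Properties
  open import Data.Product using (∃; _×_; _,_; proj₁; proj₂)
  open import Data.Sum using (_⊎_; inj₁; inj₂)
  open import Function.Bundles using (Equivalence)
  open import Relation.Binary.Definitions using (tri<; tri≈; tri>)
  open import Relation.Binary.PropositionalEquality
  open import Relation.Nullary using (¬_)

  anyUpTo-elim : ∀ n {g} → anyUpTo n g ≡ true → ∃ λ k → 1 ≤ k × k ≤ n × g k ≡ true
  anyUpTo-elim (suc n) {g} eq with g (suc n) in gn
  ... | true  = suc n , s≤s z≤n , ≤-refl , gn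
  ... | false with anyUpTo-elim n eq
  ... | k , 1≤k , k≤n , gk = k , 1≤k , m≤n⇒m≤1+n k≤n , gk

  anyUpTo-intro : ∀ n {g k} → 1 ≤ k → k ≤ n → g k ≡ true → anyUpTo n g ≡ true
  anyUpTo-intro zero    (s≤s _) () _
  anyUpTo-intro (suc n) {g} 1≤k k≤ gk with m≤n⇒m<n∨m≡n k≤
  ... | inj₂ refl rewrite gk = refl
  ... | inj₁ (s≤s k≤n) rewrite anyUpTo-intro n {g} 1≤k k≤n gk = ∨-zeroʳ (g (suc n))

  anyUpTo-cong : ∀ n {g h} → (∀ {k} → 1 ≤ k → k ≤ n → g k ≡ h k) → anyUpTo n g ≡ anyUpTo n h
  anyUpTo-cong zero    eq = refl
  anyUpTo-cong (suc n) eq = cong₂ _∨_ (eq (s≤s z≤n) ≤-refl) (anyUpTo-cong n λ 1≤k k≤n → eq 1≤k (m≤n⇒m≤1+n k≤n))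

  moves : (ℕ → ℕ → Bool) → ℕ → ℕ → Bool
  moves ℓ x y = anyUpTo x (λ k → ℓ (x ∸ k) y) ∨ anyUpTo y (λ k → ℓ x (y ∸ k)) ∨ anyUpTo (x ⊓ y) (λ k → ℓ (x ∸ k) (y ∸ k))

  moves-cong : ∀ {ℓ ℓ' x y} → (∀ {x' y'} → x' + y' < x + y → ℓ x' y' ≡ ℓ' x' y') → moves ℓ x y ≡ moves ℓ' x y
  moves-cong {x = x} {y} eq = cong₂ _∨_
    (anyUpTo-cong x λ 1≤k k≤x → eq (+-monoˡ-< y (∸-smaller 1≤k k≤x)))
    (cong₂ _∨_ (anyUpTo-cong y λ 1≤k k≤y → eq (+-monoʳ-< x (∸-smaller 1≤k k≤y)))
      (anyUpTo-cong (x ⊓ y) λ {k} 1≤k k≤ → eq (+-mono-<-≤ (∸-smaller 1≤k (≤-trans k≤ (m⊓n≤m x y))) (m∸n≤m y k))))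
    where
    ∸-smaller : ∀ {k x} → 1 ≤ k → k ≤ x → x ∸ k < x
    ∸-smaller {suc k} {suc x} _ _ = s≤s (m∸n≤m x k)

  module _ (𝒫 𝒩 : List Pos) where

    label-suc : ∀ f {x y} → elemᵇ (x , y) 𝒫 ≡ false → elemᵇ (x , y) 𝒩 ≡ false →
      labelFuel 𝒫 𝒩 (suc f) x y ≡ not (moves (labelFuel 𝒫 𝒩 f) x y)
    label-suc f {x} {y} p n with elemᵇ (x , y) 𝒫 | elemᵇ (x , y) 𝒩
    label-suc f refl refl | false | false = refl

    -- Every move lowers `x + y`, so fuel at least `x + y` suffices all the way down; fuel zero is
    -- met only at the origin, which has no moves.
    label-stable : ∀ {f g x y} → x + y ≤ f → x + y ≤ g → labelFuel 𝒫 𝒩 f x y ≡ labelFuel 𝒫 𝒩 g x y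
    label-stable {f} {g} {x} {y} ≤f ≤g with elemᵇ (x , y) 𝒫 | elemᵇ (x , y) 𝒩
    ... | true  | _     = refl
    ... | false | true  = refl
    label-stable {zero}  {zero}  ≤f ≤g | false | false = refl
    label-stable {zero}  {suc g} {zero} {zero} ≤f ≤g | false | false = refl
    label-stable {suc f} {zero}  {zero} {zero} ≤f ≤g | false | false = refl
    label-stable {suc f} {suc g} {x} {y} ≤f ≤g | false | false =
      cong not (moves-cong {labelFuel 𝒫 𝒩 f} {labelFuel 𝒫 𝒩 g} {x} {y} λ {x'} {y'} lt →
        label-stable {x = x'} {y'} (≤-pred (≤-trans lt ≤f)) (≤-pred (≤-trans lt ≤g)))

    isP-moves : ∀ {x y} → elemᵇ (x , y) 𝒫 ≡ false → elemᵇ (x , y) 𝒩 ≡ false →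
      isP 𝒫 𝒩 x y ≡ not (moves (isP 𝒫 𝒩) x y)
    isP-moves {x} {y} p n = trans (label-stable {x + y} {suc (x + y)} {x} {y} ≤-refl (n≤1+n _))
      (trans (label-suc (x + y) p n) (cong not (moves-cong {x = x} {y} λ {x'} {y'} lt → label-stable {x = x'} {y'} (<⇒≤ lt) ≤-refl)))

  elemᵇ⇒<tOf : ∀ {x y} L → elemᵇ (x , y) L ≡ true → x < tOf L
  elemᵇ⇒<tOf {x} {y} ((a , b) ∷ L) eq with x ≡ᵇ a in x≡a | y ≡ᵇ b
  ... | true | true = s≤s (subst (_≤ a ⊔ _) (sym (≡ᵇ⇒≡ x a (Equivalence.from T-≡ x≡a))) (m≤m⊔n a _))
  ... | true  | false = s≤s (≤-trans (≤-pred (elemᵇ⇒<tOf L eq)) (m≤n⊔m a _))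
  ... | false | _     = s≤s (≤-trans (≤-pred (elemᵇ⇒<tOf L eq)) (m≤n⊔m a _))

  elemᵇ-++ˡ : ∀ {p} L M → elemᵇ p L ≡ true → elemᵇ p (L ++ M) ≡ true
  elemᵇ-++ˡ {p} (q ∷ L) M eq with p ≡ₚ q
  ... | true  = refl
  ... | false = elemᵇ-++ˡ L M eq

  elemᵇ-++ʳ : ∀ {p} L M → elemᵇ p M ≡ true → elemᵇ p (L ++ M) ≡ true
  elemᵇ-++ʳ []      M eq = eq
  elemᵇ-++ʳ {p} (q ∷ L) M eq rewrite elemᵇ-++ʳ {p} L M eq = ∨-zeroʳ (p ≡ₚ q)

  Unaltered : List Pos → List Pos → ℕ → Set
  Unaltered 𝒫 𝒩 t = ∀ x y → t ≤ x → elemᵇ (x , y) 𝒫 ≡ false × elemᵇ (x , y) 𝒩 ≡ false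

  unaltered-from-tOf : ∀ 𝒫 𝒩 → Unaltered 𝒫 𝒩 (tOf (𝒫 ++ 𝒩))
  unaltered-from-tOf 𝒫 𝒩 x y t≤x = not-in {𝒫} (elemᵇ-++ˡ 𝒫 𝒩) , not-in {𝒩} (elemᵇ-++ʳ 𝒫 𝒩)
    where
    not-in : ∀ {L} → (elemᵇ (x , y) L ≡ true → elemᵇ (x , y) (𝒫 ++ 𝒩) ≡ true) → elemᵇ (x , y) L ≡ false
    not-in {L} f with elemᵇ (x , y) L
    ... | false = refl
    ... | true  = ⊥-elim (<⇒≱ (elemᵇ⇒<tOf (𝒫 ++ 𝒩) (f refl)) t≤x)

  module Columns (𝒫 𝒩 : List Pos) (t : ℕ) (free : Unaltered 𝒫 𝒩 t) where

    P : ℕ → ℕ → Set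
    P x y = isP 𝒫 𝒩 x y ≡ true

    private
      not-true : ∀ {b} → not b ≡ true → b ≢ true
      not-true {false} _ ()

      no-move : ∀ {x y} → t ≤ x → P x y → moves (isP 𝒫 𝒩) x y ≢ true
      no-move t≤x p = not-true (trans (sym (isP-moves 𝒫 𝒩 (proj₁ (free _ _ t≤x)) (proj₂ (free _ _ t≤x)))) p)

    row-unique : ∀ {x x' y} → t ≤ x → P x y → x' < x → ¬ P x' y
    row-unique {x} {x'} {y} t≤x p x'<x p' = no-move t≤x p moved
      where
      moved : moves (isP 𝒫 𝒩) x y ≡ true
      moved rewrite anyUpTo-intro x {λ k → isP 𝒫 𝒩 (x ∸ k) y} {x ∸ x'} (m<n⇒0<n∸m x'<x) (m∸n≤m x x')
        (trans (cong (λ a → isP 𝒫 𝒩 a y) (m∸[m∸n]≡n (<⇒≤ x'<x))) p') = refl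

    column-unique< : ∀ {x y y'} → t ≤ x → P x y → y' < y → ¬ P x y'
    column-unique< {x} {y} {y'} t≤x p y'<y p' = no-move t≤x p moved
      where
      moved : moves (isP 𝒫 𝒩) x y ≡ true
      moved rewrite anyUpTo-intro y {λ k → isP 𝒫 𝒩 x (y ∸ k)} {y ∸ y'} (m<n⇒0<n∸m y'<y) (m∸n≤m y y')
        (trans (cong (isP 𝒫 𝒩 x) (m∸[m∸n]≡n (<⇒≤ y'<y))) p') = ∨-zeroʳ _

    diagonal-unique : ∀ {x y k} → t ≤ x + k → P (x + k) (y + k) → 1 ≤ k → ¬ P x y
    diagonal-unique {x} {y} {k} t≤ p 1≤k p' = no-move t≤ p moved
      where
      moved : moves (isP 𝒫 𝒩) (x + k) (y + k) ≡ true
      moved rewrite anyUpTo-intro ((x + k) ⊓ (y + k)) {λ k' → isP 𝒫 𝒩 (x + k ∸ k') (y + k ∸ k')} 1≤k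
          (⊓-glb (m≤n+m k x) (m≤n+m k y)) (trans (cong₂ (isP 𝒫 𝒩) (m+n∸n≡m x k) (m+n∸n≡m y k)) p')
        | ∨-zeroʳ (anyUpTo (y + k) (λ k' → isP 𝒫 𝒩 (x + k) (y + k ∸ k'))) = ∨-zeroʳ _

    data Reaches (x y : ℕ) : Set where
      left  : ∀ {x'} → x' < x → P x' y → Reaches x y
      below : ∀ {y'} → y' < y → P x y' → Reaches x y
      diag  : ∀ {x' y' k} → 1 ≤ k → x ≡ x' + k → y ≡ y' + k → P x' y' → Reaches x y

    reaches : ∀ {x y} → t ≤ x → ¬ P x y → Reaches x y
    reaches {x} {y} t≤x ¬p = split moved
      where
      X = anyUpTo x (λ k → isP 𝒫 𝒩 (x ∸ k) y)
      Y = anyUpTo y (λ k → isP 𝒫 𝒩 x (y ∸ k))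
      Z = anyUpTo (x ⊓ y) (λ k → isP 𝒫 𝒩 (x ∸ k) (y ∸ k))
      not-not : ∀ {b c} → c ≡ not b → c ≢ true → b ≡ true
      not-not {true}  _    _  = refl
      not-not {false} refl c≢ = ⊥-elim (c≢ refl)
      moved : X ∨ Y ∨ Z ≡ true
      moved = not-not (isP-moves 𝒫 𝒩 (proj₁ (free _ _ t≤x)) (proj₂ (free _ _ t≤x))) ¬p
      ∸-smaller : ∀ {k x} → 1 ≤ k → k ≤ x → x ∸ k < x
      ∸-smaller {suc k} {suc x} _ _ = s≤s (m∸n≤m x k)
      cases : ∀ {a b c} → a ∨ b ∨ c ≡ true → a ≡ true ⊎ b ≡ true ⊎ c ≡ true
      cases {true}                 _ = inj₁ refl
      cases {false} {true}         _ = inj₂ (inj₁ refl)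
      cases {false} {false} {true} _ = inj₂ (inj₂ refl)
      split : X ∨ Y ∨ Z ≡ true → Reaches x y
      split eq with cases {X} {Y} {Z} eq
      ... | inj₁ a with anyUpTo-elim x a
      ... | k , 1≤k , k≤ , p = left (∸-smaller 1≤k k≤) p
      split eq | inj₂ (inj₁ b) with anyUpTo-elim y b
      ... | k , 1≤k , k≤ , p = below (∸-smaller 1≤k k≤) p
      split eq | inj₂ (inj₂ c) with anyUpTo-elim (x ⊓ y) c
      ... | k , 1≤k , k≤ , p = diag 1≤k (sym (m∸n+n≡m (≤-trans k≤ (m⊓n≤m x y)))) (sym (m∸n+n≡m (≤-trans k≤ (m⊓n≤n x y)))) p

    column-unique : ∀ {x y y'} → t ≤ x → P x y → P x y' → y ≡ y'
    column-unique {x} {y} {y'} t≤x p p' with <-cmp y y'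
    ... | tri< lt _ _ = ⊥-elim (column-unique< t≤x p' lt p)
    ... | tri≈ _ eq _ = eq
    ... | tri> _ _ gt = ⊥-elim (column-unique< t≤x p gt p')

    Bounded : ℕ → ℕ → Set
    Bounded x M = ∀ {x' y} → x' < x → P x' y → y ≤ M

    -- Consider the position at height `suc M + x`. A horizontal move keeps that height, and a
    -- diagonal move has at most `x` steps, so both end above `M` in an earlier column, where no
    -- P-position lies. If the position is not P itself, its P-successor must be in its own column.
    column-inhabited : ∀ {x M} → t ≤ x → Bounded x M → ∃ (P x)
    column-inhabited {x} {M} t≤x bd with isP 𝒫 𝒩 x (suc M + x) in eq
    ... | true  = suc M + x , eq
    ... | false with reaches {x} {suc M + x} t≤x (λ p → false≢true (trans (sym eq) p))
      where
      false≢true : false ≢ true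
      false≢true ()
    ... | left x'<x p = ⊥-elim (<⇒≱ (s≤s (m≤m+n M x)) (bd x'<x p))
    ... | below _ p   = _ , p
    ... | diag {x'} {y'} {k} 1≤k x≡ y≡ p = ⊥-elim (<⇒≱ M<y' (bd x'<x p))
      where
      x'<x : x' < x
      x'<x rewrite x≡ = subst (_≤ x' + k) (+-comm x' 1) (+-monoʳ-≤ x' 1≤k)
      k≤x : k ≤ x
      k≤x rewrite x≡ = m≤n+m k x'
      M<y' : suc M ≤ y'
      M<y' = +-cancelʳ-≤ k (suc M) y' (≤-trans (+-monoʳ-≤ (suc M) k≤x) (≤-reflexive y≡))

    bounded : ∀ {M} → Bounded t M → ∀ n → ∃ (Bounded (n + t))
    bounded {M} bd zero    = M , bd
    bounded {M} bd (suc n) with bounded bd n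
    ... | M' , bd' with column-inhabited (m≤n+m t n) bd'
    ... | y , p = M' ⊔ y , bd″
      where
      bd″ : Bounded (suc n + t) (M' ⊔ y)
      bd″ (s≤s x'≤) p' with m≤n⇒m<n∨m≡n x'≤
      ... | inj₁ x'<  = ≤-trans (bd' x'< p') (m≤m⊔n M' y)
      ... | inj₂ refl = ≤-trans (≤-reflexive (column-unique (m≤n+m t n) p' p)) (m≤n⊔m M' y)

    column : ∀ {M x} → Bounded t M → t ≤ x → ∃ (P x)
    column {x = x} bd t≤x with bounded bd (x ∸ t)
    ... | M , bd' = column-inhabited {M = M} t≤x (subst (λ x → Bounded x M) (m∸n+n≡m t≤x) bd')

-- The translated game as an instance of the greedy process.

module Game where
  open import Data.Bool using (true)
  open import Data.Empty using (⊥-elim)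
  open import Data.Integer using (ℤ; +_; -[1+_]; _+_; _-_; -_; _≤_; _≤?_; ∣_∣; +≤+; drop‿+≤+)
  open import Data.Integer.Properties using (≤-refl; ≤-trans; 0≤i⇒+∣i∣≡i; +-injective; i≤j⇒0≤j-i; _≟_; i≤suc[i])
  open import Data.Integer.Tactic.RingSolver using (solve; solve-∀)
  open import Data.List using (List; []; _∷_; _++_; length; map; upTo; cartesianProduct)
  open import Data.List.Membership.Propositional using (_∈_)
  open import Data.List.Membership.Propositional.Properties using (∈-map⁺; ∈-map⁻; ∈-cartesianProduct⁺; ∈-++⁺ˡ; ∈-++⁺ʳ; ∈-upTo⁺)
  open import Data.List.Properties using (length-map)
  open import Data.List.Relation.Unary.Any using (here; there)
  open import Data.List.Relation.Unary.Unique.Propositional using (Unique)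
  open import Data.List.Relation.Unary.Unique.Propositional.Properties using (map⁺)
  open import Data.Nat as ℕ using (ℕ; z≤n; _∸_)
  import Data.Nat.Properties as ℕ
  open import Data.Nat.ListAction using (sum)
  open import Data.Product using (∃; _×_; _,_; proj₁; proj₂)
  open import Data.Sum using (_⊎_; inj₁; inj₂)
  open import Function.Bundles using (_⇔_; Equivalence)
  open import Relation.Binary.PropositionalEquality
  open import Relation.Nullary using (¬_; yes; no)
  open Linear
  open Counting
  open Settling
  open Label
  open Asymptotics

  ∈⇒≤sum : ∀ {y ys} → y ∈ ys → y ℕ.≤ sum ys
  ∈⇒≤sum {ys = y ∷ ys} (here refl) = ℕ.m≤m+n y (sum ys)
  ∈⇒≤sum {ys = z ∷ ys} (there y∈)  = ℕ.≤-trans (∈⇒≤sum y∈) (ℕ.m≤n+m (sum ys) z)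

  private
    [a+b]-b : ∀ a b → a + b - b ≡ a
    [a+b]-b = solve-∀
    [a-b]+b : ∀ a b → a - b + b ≡ a
    [a-b]+b = solve-∀
    +-cancel : ∀ {a a'} b → a + b ≡ a' + b → a ≡ a'
    +-cancel {a} {a'} b eq = trans (sym ([a+b]-b a b)) (trans (cong (_- b) eq) ([a+b]-b a' b))

  -- `t` is a parameter rather than `tOf (𝒫 ++ 𝒩)`, which is never 0: the unaltered game enters with
  -- `t = 0` and empty lists.
  module AlteredGame (𝒫 𝒩 : List Pos) (t : ℕ) (free : Unaltered 𝒫 𝒩 t)
    {Ys : List ℕ} (Ys-unique : Unique Ys)
    (Ys⇔ : ∀ y → (y ∈ Ys) ⇔ (∃ λ x → (x ℕ.< t) × (isP 𝒫 𝒩 x y ≡ true)))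
    {Ks : List ℤ} (Ks-unique : Unique Ks)
    (Ks⇔ : ∀ k → (k ∈ Ks) ⇔ (∃ λ x → ∃ λ y → (x ℕ.< t) × (isP 𝒫 𝒩 x y ≡ true) × (k ≡ + y - + x))) where

    open Columns 𝒫 𝒩 t free

    d r Δx Δy : ℤ
    d  = + length Ks
    r  = + length Ys
    Δx = d - + t
    Δy = d - r

    S : SetZ²
    S = shift (Pset 𝒫 𝒩) Δx Δy

    -- A record, so that the coordinates can be inferred from a proof; the bare equation would
    -- reduce and lose them.
    record Cell (X Y : ℤ) : Set where
      constructor in-S
      field is-P : S X Y ≡ true

    Row Diag : ℤ → ℤ → Set
    Row X Y  = ∃ λ X' → + 1 + X' ≤ X × Cell X' Y
    Diag X k = ∃ λ X' → ∃ λ Y' → + 1 + X' ≤ X × Cell X' Y' × k ≡ Y' - X'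

    -- Views a cell through its coordinates before translation, so that the facts about natural
    -- positions apply.
    data Raw : ℤ → ℤ → Set where
      raw : ∀ {x y} → P x y → Raw (+ x + Δx) (+ y + Δy)

    to-raw : ∀ {X Y} → Cell X Y → Raw X Y
    to-raw {X} {Y} (in-S c) with X - Δx in X≡ | Y - Δy in Y≡
    ... | + x | + y = subst₂ Raw (trans (cong (_+ Δx) (sym X≡)) ([a-b]+b X Δx))
                                 (trans (cong (_+ Δy) (sym Y≡)) ([a-b]+b Y Δy)) (raw c)
    to-raw (in-S ()) | + _ | -[1+ _ ]
    to-raw (in-S ()) | -[1+ _ ] | _

    from-raw : ∀ {x y} → P x y → Cell (+ x + Δx) (+ y + Δy)
    from-raw {x} {y} p = in-S (trans (cong₂ (Pset 𝒫 𝒩) ([a+b]-b (+ x) Δx) ([a+b]-b (+ y) Δy)) p)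

    t≤ : ∀ {x} → d ≤ + x + Δx → t ℕ.≤ x
    t≤ {x} h = drop‿+≤+ (shifted (+ x) d (+ t) h)
      where
      shifted : ∀ x d t → d ≤ x + (d - t) → t ≤ x
      shifted x d t h = lin 0 h (solve (x ∷ d ∷ t ∷ []))

    shift-< : ∀ {x x'} → x' ℕ.< x → + 1 + (+ x' + Δx) ≤ + x + Δx
    shift-< {x} {x'} lt = shifted (+ x) (+ x') Δx (+≤+ lt)
      where
      shifted : ∀ x x' e → + 1 + x' ≤ x → + 1 + (x' + e) ≤ x + e
      shifted x x' e h = lin 0 h (solve (x ∷ x' ∷ e ∷ []))

    unshift-< : ∀ {x x'} e → + 1 + (+ x' + e) ≤ + x + e → x' ℕ.< x
    unshift-< {x} {x'} e h = drop‿+≤+ (shifted (+ x) (+ x') e h)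
      where
      shifted : ∀ x x' e → + 1 + (x' + e) ≤ x + e → + 1 + x' ≤ x
      shifted x x' e h = lin 0 h (solve (x ∷ x' ∷ e ∷ []))

    <t : ∀ {x} → + 1 + (+ x + Δx) ≤ d → x ℕ.< t
    <t {x} h = drop‿+≤+ (shifted (+ x) d (+ t) h)
      where
      shifted : ∀ x d t → + 1 + (x + (d - t)) ≤ d → + 1 + x ≤ t
      shifted x d t h = lin 0 h (solve (x ∷ d ∷ t ∷ []))

    <d : ∀ {x} → x ℕ.< t → + 1 + (+ x + Δx) ≤ d
    <d {x} h = shifted (+ x) d (+ t) (+≤+ h)
      where
      shifted : ∀ x d t → + 1 + x ≤ t → + 1 + (x + (d - t)) ≤ d
      shifted x d t h = lin 0 h (solve (x ∷ d ∷ t ∷ []))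

    data Shifted (e : ℤ) : ℤ → Set where
      _shifted : ∀ x → Shifted e (+ x + e)

    unshift : ∀ e {X} → e ≤ X → Shifted e X
    unshift e {X} h = subst (Shifted e) (trans (cong (_+ e) (0≤i⇒+∣i∣≡i (i≤j⇒0≤j-i h))) ([a-b]+b X e)) (∣ X - e ∣ shifted)

    Δx≤ : ∀ {X} → d ≤ X → Δx ≤ X
    Δx≤ {X} h = lemma X d (+ t) (+≤+ z≤n) h
      where
      lemma : ∀ X d t → + 0 ≤ t → d ≤ X → d - t ≤ X
      lemma X d t p h = lin 0 (p ⊕ h) (solve (X ∷ d ∷ t ∷ []))

    first-columns : Bounded t (sum Ys)
    first-columns x<t p = ∈⇒≤sum (Equivalence.from (Ys⇔ _) (_ , x<t , p))

    cell-unique : ∀ {X Y Y'} → d ≤ X → Cell X Y → Cell X Y' → Y ≡ Y'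
    cell-unique {X} d≤X c c' = go (to-raw c) (to-raw c') refl
      where
      go : ∀ {X' Y Y'} → Raw X Y → Raw X' Y' → X ≡ X' → Y ≡ Y'
      go (raw {x} p) (raw {x'} p') eq with +-injective (+-cancel {+ x} {+ x'} Δx eq)
      ... | refl = cong (λ y → + y + Δy) (column-unique (t≤ d≤X) p p')

    Cell-floor : ∀ {X Y} → Cell X Y → Δy ≤ Y
    Cell-floor c with to-raw c
    ... | raw {x} {y} p = lemma (+ y) Δy (+≤+ z≤n)
      where
      lemma : ∀ y e → + 0 ≤ y → e ≤ y + e
      lemma y e h = lin 0 h (solve (y ∷ e ∷ []))

    Row-fresh : ∀ {X Y} → d ≤ X → Cell X Y → ¬ Row X Y
    Row-fresh {X} {Y} d≤X c (X' , X'<X , c') = go (to-raw c) (to-raw c') refl d≤X X'<X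
      where
      go : ∀ {X X' Y Y'} → Raw X Y → Raw X' Y' → Y ≡ Y' → d ≤ X → ¬ + 1 + X' ≤ X
      go (raw {x} {y} p) (raw {x'} {y'} p') eq d≤X X'<X with +-injective (+-cancel {+ y} {+ y'} Δy eq)
      ... | refl = row-unique (t≤ d≤X) p (unshift-< Δx X'<X) p'

    Diag-fresh : ∀ {X Y} → d ≤ X → Cell X Y → ¬ Diag X (Y - X)
    Diag-fresh {X} {Y} d≤X c (X' , Y' , X'<X , c' , eq) = go (to-raw c) (to-raw c') eq d≤X X'<X
      where
      go : ∀ {X X' Y Y'} → Raw X Y → Raw X' Y' → Y - X ≡ Y' - X' → d ≤ X → ¬ + 1 + X' ≤ X
      go (raw {x} {y} p) (raw {x'} {y'} p') eq d≤X X'<X =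
        diagonal-unique (subst (t ℕ.≤_) x≡ (t≤ d≤X)) (subst₂ P x≡ (+-injective (y≡ (+ x) (+ x') (+ y) (+ y') Δx Δy (+ (x ∸ x')) (cong +_ x≡) eq)) p)
          (ℕ.m<n⇒0<n∸m x'<x) p'
        where
        x'<x : x' ℕ.< x
        x'<x = unshift-< Δx X'<X
        x≡ : x ≡ x' ℕ.+ (x ∸ x')
        x≡ = sym (ℕ.m+[n∸m]≡n (ℕ.<⇒≤ x'<x))
        y≡ : ∀ x x' y y' e f k → x ≡ x' + k → y + f - (x + e) ≡ y' + f - (x' + e) → y ≡ y' + k
        y≡ x x' y y' e f k eq eq' = ≤-both
          (lin 0 (≡⇒≤ eq ⊕ ≡⇒≤ eq') (solve (x ∷ x' ∷ y ∷ y' ∷ e ∷ f ∷ k ∷ [])))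
          (lin 0 (≡⇒≤ (sym eq) ⊕ ≡⇒≤ (sym eq')) (solve (x ∷ x' ∷ y ∷ y' ∷ e ∷ f ∷ k ∷ [])))

    Greedy-choice : ∀ {X Y Y'} → d ≤ X → Cell X Y → Δy ≤ Y' → + 1 + Y' ≤ Y → Row X Y' ⊎ Diag X (Y' - X)
    Greedy-choice {X} {Y} {Y'} d≤X c floor Y'<Y = go (to-raw c) (unshift Δy floor) d≤X Y'<Y
      where
      go : ∀ {X Y Y'} → Raw X Y → Shifted Δy Y' → d ≤ X → + 1 + Y' ≤ Y → Row X Y' ⊎ Diag X (Y' - X)
      go (raw {x} {y} p) (y' shifted) d≤X Y'<Y
        with reaches {x} {y'} (t≤ d≤X) (column-unique< (t≤ d≤X) p (unshift-< Δy Y'<Y))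
      ... | left x'<x p'     = inj₁ (_ , shift-< x'<x , from-raw p')
      ... | below y″<y' p'   = ⊥-elim (column-unique< (t≤ d≤X) p (ℕ.<-trans y″<y' (unshift-< Δy Y'<Y)) p')
      ... | diag {x'} {y″} {k} 1≤k refl refl p' =
        inj₂ (_ , _ , shift-< (ℕ.≤-trans (ℕ.≤-reflexive (ℕ.+-comm 1 x')) (ℕ.+-monoʳ-≤ x' 1≤k)) , from-raw p' , same (+ x') (+ y″) (+ k) Δx Δy)
        where
        same : ∀ x y k e f → y + k + f - (x + k + e) ≡ y + f - (x + e)
        same = solve-∀

    Cell-exists : ∀ {X} → d ≤ X → ∃ (Cell X)
    Cell-exists d≤X with unshift Δx (Δx≤ d≤X)
    ... | x shifted with column first-columns (t≤ d≤X)
    ... | y , p = _ , from-raw p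

    -- The vertical shift is chosen for this: with lowest row `d - r`, the `r` used rows number `d`
    -- minus the lowest row.
    Row-count : Count (Row d) (d - Δy)
    Row-count = count (map (λ y → + y + Δy) Ys)
      (map⁺ (λ {y} {y'} eq → +-injective (+-cancel {+ y} {+ y'} Δy eq)) Ys-unique)
      sound complete (trans (cong +_ (length-map (λ y → + y + Δy) Ys)) (size d r))
      where
      size : ∀ d r → r ≡ d - (d - r)
      size = solve-∀
      sound : ∀ {Y} → Y ∈ map (λ y → + y + Δy) Ys → Row d Y
      sound Y∈ with ∈-map⁻ (λ y → + y + Δy) Y∈
      ... | y , y∈ , refl with Equivalence.to (Ys⇔ y) y∈
      ... | x , x<t , p = _ , <d x<t , from-raw p
      complete : ∀ {Y} → Row d Y → Y ∈ map (λ y → + y + Δy) Ys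
      complete (X , X<d , c) with to-raw c
      ... | raw p = ∈-map⁺ (λ y → + y + Δy) (Equivalence.from (Ys⇔ _) (_ , <t X<d , p))

    -- The horizontal shift is chosen for this: the first unaltered column gets the number of
    -- diagonals used before it. The translation moves every diagonal by `Δy - Δx`.
    Diag-count : Count (Diag d) d
    Diag-count = count (map f Ks) (map⁺ (λ {k} {k'} eq → +-cancel {k} {k'} (Δy - Δx) eq) Ks-unique)
      sound complete (cong +_ (length-map f Ks))
      where
      f : ℤ → ℤ
      f k = k + (Δy - Δx)
      diagonal : ∀ x y e g → y - x + (g - e) ≡ y + g - (x + e)
      diagonal = solve-∀
      sound : ∀ {k} → k ∈ map f Ks → Diag d k
      sound k∈ with ∈-map⁻ f k∈
      ... | k , k∈′ , refl with Equivalence.to (Ks⇔ k) k∈′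
      ... | x , y , x<t , p , refl = _ , _ , <d x<t , from-raw p , diagonal (+ x) (+ y) Δx Δy
      complete : ∀ {k} → Diag d k → k ∈ map f Ks
      complete (X , Y , X<d , c , refl) with to-raw c
      ... | raw {x} {y} p = subst (_∈ map f Ks) (diagonal (+ x) (+ y) Δx Δy)
        (∈-map⁺ f (Equivalence.from (Ks⇔ _) (x , y , <t X<d , p , refl)))

    ≤-split : ∀ a b → + 1 + a ≤ + 1 + b → + 1 + a ≤ b ⊎ a ≡ b
    ≤-split a b h with a ≟ b
    ... | yes eq = inj₂ eq
    ... | no a≢b = inj₁ (≤≢⇒< (pred-≤ a b h) a≢b)
      where
      pred-≤ : ∀ a b → + 1 + a ≤ + 1 + b → a ≤ b
      pred-≤ a b h = lin 0 h (solve (a ∷ b ∷ []))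

    greedy : Greedy
    greedy = record
      { d = d ; z = Δy ; Cell = Cell ; Row = Row ; Diag = Diag
      ; d-nonneg   = +≤+ z≤n
      ; cell       = Cell-exists
      ; cell-floor = λ _ → Cell-floor
      ; greedy     = Greedy-choice
      ; row-fresh  = Row-fresh
      ; row-keep   = λ (_ , lt , c) → _ , ≤-trans lt (i≤suc[i] _) , c
      ; row-new    = λ _ c → _ , ≤-refl , c
      ; row-step   = row-step′
      ; row-floor  = λ (_ , _ , c) → Cell-floor c
      ; row-count  = Row-count
      ; diag-fresh = Diag-fresh
      ; diag-keep  = λ (_ , _ , lt , ck) → _ , _ , ≤-trans lt (i≤suc[i] _) , ck
      ; diag-new   = λ _ c → _ , _ , ≤-refl , c , refl
      ; diag-step  = diag-step′
      ; diag-count = Diag-count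
      }
      where
      row-step′ : ∀ {x y y'} → d ≤ x → Cell x y → Row (+ 1 + x) y' → Row x y' ⊎ y' ≡ y
      row-step′ {x} d≤x c (x' , lt , c') with ≤-split x' x lt
      ... | inj₁ lt′  = inj₁ (x' , lt′ , c')
      ... | inj₂ refl = inj₂ (cell-unique d≤x c' c)
      diag-step′ : ∀ {x y k} → d ≤ x → Cell x y → Diag (+ 1 + x) k → Diag x k ⊎ k ≡ y - x
      diag-step′ {x} d≤x c (x' , y' , lt , c' , eq) with ≤-split x' x lt
      ... | inj₁ lt′  = inj₁ (x' , y' , lt′ , c' , eq)
      ... | inj₂ refl = inj₂ (trans eq (cong (_- x') (cell-unique d≤x c' c)))

    -- The value 0 before column `d` is a default; there it can only add harmless points to the
    -- finite list in `columnar`.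
    col : ℕ → ℤ
    col x with d ≤? + x
    ... | yes d≤x = proj₁ (Cell-exists d≤x)
    ... | no  _   = + 0

    col-unique : ∀ {x Y} → d ≤ + x → Cell (+ x) Y → Y ≡ col x
    col-unique {x} d≤x c with d ≤? + x
    ... | yes d≤x′ = cell-unique d≤x c (proj₂ (Cell-exists d≤x′))
    ... | no  d≰x  = ⊥-elim (d≰x d≤x)

    -- `S'` allows for the unaltered game, where `S` is `Bset` shifted by zero and equals `Bset`
    -- only pointwise.
    columnar : ∀ {S'} → (∀ a b → S a b ≡ S' a b) → Columnar S' Cell
    columnar {S'} S≡S' = record
      { to     = λ {a} {b} c → trans (sym (S≡S' a b)) (Cell.is-P c)
      ; D      = length Ks
      ; col    = col
      ; unique = λ D≤x s → col-unique (+≤+ D≤x) (in-S (trans (S≡S' _ _) s))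
      ; old    = λ X → L X , λ {a} {b} s → split X a b (in-S (trans (S≡S' a b) s))
      }
      where
      module R = Count Row-count
      module D = Count Diag-count
      L₀ : List (ℤ × ℤ)
      L₀ = map (λ (y , k) → y - k , y) (cartesianProduct R.elements D.elements)
      L : ℕ → List (ℤ × ℤ)
      L X = L₀ ++ map (λ x → + x , col x) (upTo X)
      -- Before column d a cell is determined by its row and its diagonal.
      split : ∀ X a b → Cell a b → (a , b) ∈ L X ⊎ ∃ λ x → X ℕ.≤ x × a ≡ + x × b ≡ col x
      split X a b c with d ≤? a
      ... | no  d≰a = inj₁ (∈-++⁺ˡ (subst (λ a → (a , b) ∈ L₀) (lemma a b)
                        (∈-map⁺ (λ (y , k) → y - k , y) (∈-cartesianProduct⁺
                          (R.complete (a , not≤ d≰a , c)) (D.complete (a , b , not≤ d≰a , c , refl))))))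
        where
        lemma : ∀ a b → b - (b - a) ≡ a
        lemma = solve-∀
      split X (+ x) b c | yes d≤x with X ℕ.≤? x
      ... | yes X≤x = inj₂ (x , X≤x , refl , col-unique d≤x c)
      ... | no  X≰x = inj₁ (∈-++⁺ʳ L₀ (subst (λ b → (+ x , b) ∈ map (λ x → + x , col x) (upTo X)) (sym (col-unique d≤x c))
                        (∈-map⁺ (λ x → + x , col x) (∈-upTo⁺ (ℕ.≰⇒> X≰x)))))

-- The altered game against the unaltered one.

open import Data.Integer.Properties as ℤ using (+-identityʳ)
import Data.List.Relation.Unary.AllPairs as AllPairs
open import Relation.Binary.PropositionalEquality using (refl; cong₂)
open import Function.Bundles using (mk⇔)
open Phases using (profile)
open Compare using (agreement)
open Asymptotics using (asymptotic)
open Label using (Unaltered; unaltered-from-tOf)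
open Game using (module AlteredGame)
open import Data.Nat using (ℕ; _<_)
open import Data.Integer as ℤ using (ℤ; +_)
open import Data.Bool using (true)
open import Data.Product using (_×_; ∃; _,_)
open import Data.List using (List; []; _++_; length)
open import Data.List.Membership.Propositional using (_∈_)
open import Data.List.Relation.Unary.Unique.Propositional using (Unique)
open import Relation.Binary.PropositionalEquality using (_≡_)
open import Relation.Nullary using (¬_)
open import Function.Bundles using (_⇔_)

theorem3 : (𝒫 𝒩 : List Pos)
    → (∀ p → p ∈ 𝒫 → ¬ (p ∈ 𝒩))
    → ¬ (𝒫 ++ 𝒩 ≡ [])
    → (Ys : List ℕ) → Unique Ys
    → (∀ y → (y ∈ Ys) ⇔ (∃ λ x → (x < tOf (𝒫 ++ 𝒩)) × (isP 𝒫 𝒩 x y ≡ true)))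
    → (Ks : List ℤ) → Unique Ks
    → (∀ k → (k ∈ Ks) ⇔ (∃ λ x → ∃ λ y → (x < tOf (𝒫 ++ 𝒩)) × (isP 𝒫 𝒩 x y ≡ true) × (k ≡ + y ℤ.- + x)))
    → AsymptoticallyEqual
    (shift (Pset 𝒫 𝒩) (+ length Ks ℤ.- + tOf (𝒫 ++ 𝒩)) (+ length Ks ℤ.- + length Ys))
    Bset
theorem3 𝒫 𝒩 _ _ Ys Ys-unique Ys⇔ Ks Ks-unique Ks⇔ =
  asymptotic (A.columnar λ _ _ → refl) (B.columnar λ a b → cong₂ Bset (ℤ.+-identityʳ a) (ℤ.+-identityʳ b))
    (agreement (profile A.greedy) (profile B.greedy))
  where
  module A = AlteredGame 𝒫 𝒩 (tOf (𝒫 ++ 𝒩)) (unaltered-from-tOf 𝒫 𝒩) Ys-unique Ys⇔ Ks-unique Ks⇔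
  nothing-altered : Unaltered [] [] 0
  nothing-altered _ _ _ = refl , refl
  no-rows : ∀ y → (y ∈ []) ⇔ (∃ λ x → (x < 0) × (isP [] [] x y ≡ true))
  no-rows _ = mk⇔ (λ ()) λ { (_ , () , _) }
  no-diagonals : ∀ k → (k ∈ []) ⇔ (∃ λ x → ∃ λ y → (x < 0) × (isP [] [] x y ≡ true) × (k ≡ + y ℤ.- + x))
  no-diagonals _ = mk⇔ (λ ()) λ { (_ , _ , () , _) }
  -- No column precedes column 0, so both counts and both components of the shift vanish.
  module B = AlteredGame [] [] 0 nothing-altered AllPairs.[] no-rows AllPairs.[] no-diagonals
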